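{- For all $h\in\mathcal{Q}\setminus\{0\}$, the GoldenNugget heap of size $h$ has value $\mathrm{val}(h)=\delta(h)$, where $\delta(h)$ is the unique dyadic rational in $[1/2,1]$ with $\xi(\delta(h))=h$.
   Context: Let $\phi=\frac{1+\sqrt5}{2}$, and for integers $n\ge 0$ let $A(n)=\lfloor n\phi\rfloor$, $B(n)=\lfloor n\phi^2\rfloor$. Fibonacci numbers: $F_0=0$, $F_1=F_2=1$, $F_n=F_{n-1}+F_{n-2}$. $\mathcal{Q}=\{B(B(n))+1: n\ge 1\}\cup\{F_{2n+3}-2: n\ge 0\}$. GoldenNugget is the normal-play partizan game played on a heap of $h\ge 0$ counters: Left's options are the heaps $h-a$ with $a\in\{A(i): i\ge 1\}$, $a\le h$; Right's options are the heaps $h-b$ with $b\in\{B(i): i\ge 1\}$, $b\le h$; a player who cannot move loses. $\mathrm{val}(h)$ is its value in the usual sense of combinatorial game theory (its game up to equality), and dyadic rationals are identified with games in the usual way. The map $\xi$: for a dyadic rational $d\in[1/2,1]$ with finite binary representation $d=d_0.d_1d_2\ldots d_k$, put $\xi(d)=\sum_{i} d_iF_{e(i)}$, where $e(0)=2$, $e(1)=4$, and for $i\ge 2$, $e(i)=e(i-1)$ if $d_{i-2}d_{i-1}=01$, and $e(i)=e(i-1)+2$ otherwise. For every $h\in\mathcal{Q}\setminus\{0\}$ there is a unique dyadic rational in $[1/2,1]$ mapped to $h$ by $\xi$; it is denoted $\delta(h)$. -}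

module Defs where

open import Data.Nat using (ℕ; zero; suc; _+_; _*_; _∸_; _^_; _≤_; _<_; z≤n; s≤s)
open import Data.Nat.Properties
open import Data.Nat.Induction using (Acc; acc; <-wellFounded)
import Data.Nat.Tactic.RingSolver as ℕ-Solver
open import Data.Integer as ℤ using (ℤ; +_; -[1+_]; _/ℕ_; _%ℕ_)
open import Data.Rational.Unnormalised as ℚᵘ using (ℚᵘ)
open import Data.Empty using (⊥)
open import Data.Unit using (⊤)
open import Data.Product using (Σ-syntax; ∃-syntax; _×_; _,_)
open import Data.Sum using (_⊎_)
open import Relation.Nullary using (¬_; Dec; yes; no)
open import Relation.Binary.PropositionalEquality using (_≡_; sym; subst)

------------------------------------------------------------------------
-- The golden ratio and the sequences A, B

-- x +φ y stands for the real number x + yφ with φ = (1 + √5)/2.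
record ℕ[φ] : Set where
  constructor _+φ_
  field
    rat gold : ℕ

φ : ℕ[φ]
φ = 0 +φ 1

-- Multiplication uses φ² = φ + 1.
infixl 7 _⊗_ _·_
_⊗_ : ℕ[φ] → ℕ[φ] → ℕ[φ]
(x +φ y) ⊗ (z +φ w) = (x * z + y * w) +φ (x * w + y * z + y * w)

_·_ : ℕ → ℕ[φ] → ℕ[φ]
n · (x +φ y) = (n * x) +φ (n * y)

-- The real inequality k ≤ x + yφ, that is 2k - (2x + y) ≤ y√5.  As the right
-- side is nonnegative, one may truncate the left side at 0 and square.
infix 4 _⊑_ _⊑?_
_⊑_ : ℕ → ℕ[φ] → Set
k ⊑ (x +φ y) = (2 * k ∸ (2 * x + y)) ^ 2 ≤ 5 * y ^ 2

_⊑?_ : ∀ k z → Dec (k ⊑ z)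
k ⊑? (x +φ y) = (2 * k ∸ (2 * x + y)) ^ 2 ≤? 5 * y ^ 2

greatest⊑ : ℕ[φ] → ℕ → ℕ
greatest⊑ z zero = zero
greatest⊑ z (suc n) with suc n ⊑? z
... | yes _ = suc n
... | no  _ = greatest⊑ z n

-- Searching up to x + 2y suffices because φ < 2; see ⌊⌋-lower and ⌊⌋-upper.
⌊_⌋ : ℕ[φ] → ℕ
⌊ x +φ y ⌋ = greatest⊑ (x +φ y) (x + 2 * y)

A B : ℕ → ℕ
A n = ⌊ n · φ ⌋
B n = ⌊ n · (φ ⊗ φ) ⌋

0⊑ : ∀ z → 0 ⊑ z
0⊑ (x +φ y) = subst (λ t → t ^ 2 ≤ 5 * y ^ 2) (sym (0∸n≡0 (2 * x + y))) z≤n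

greatest⊑-lower : ∀ z n → greatest⊑ z n ⊑ z
greatest⊑-lower z zero = 0⊑ z
greatest⊑-lower z (suc n) with suc n ⊑? z
... | yes p = p
... | no  _ = greatest⊑-lower z n

greatest⊑-upper : ∀ z n → ¬ (suc n ⊑ z) → ¬ (suc (greatest⊑ z n) ⊑ z)
greatest⊑-upper z zero    ¬p = ¬p
greatest⊑-upper z (suc n) ¬p with suc n ⊑? z
... | yes _  = ¬p
... | no  ¬q = greatest⊑-upper z n ¬q

beyond : ∀ x y → ¬ (suc (x + 2 * y) ⊑ (x +φ y))
beyond x y p = <⇒≱ big (subst (λ t → t ^ 2 ≤ 5 * y ^ 2) diff p)
  where
  split : ∀ x y → 2 * suc (x + 2 * y) ≡ (3 * y + 2) + (2 * x + y)
  split = ℕ-Solver.solve-∀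

  diff : 2 * suc (x + 2 * y) ∸ (2 * x + y) ≡ 3 * y + 2
  diff rewrite split x y = m+n∸n≡m (3 * y + 2) (2 * x + y)

  square : ∀ y → (3 * y + 2) * ((3 * y + 2) * 1)
               ≡ suc (5 * (y * (y * 1))) + (4 * (y * (y * 1)) + 12 * y + 3)
  square = ℕ-Solver.solve-∀

  big : 5 * y ^ 2 < (3 * y + 2) ^ 2
  big = subst (5 * y ^ 2 <_) (sym (square y)) (m≤m+n _ _)

⌊⌋-lower : ∀ z → ⌊ z ⌋ ⊑ z
⌊⌋-lower z@(x +φ y) = greatest⊑-lower z (x + 2 * y)

⌊⌋-upper : ∀ z → ¬ (suc ⌊ z ⌋ ⊑ z)
⌊⌋-upper z@(x +φ y) = greatest⊑-upper z (x + 2 * y) (beyond x y)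

⌊⌋-positive : ∀ z → 1 ⊑ z → 1 ≤ ⌊ z ⌋
⌊⌋-positive z p = n≢0⇒n>0 λ eq →
  ⌊⌋-upper z (subst (λ t → suc t ⊑ z) (sym eq) p)

1⊑ : ∀ z → 2 ≤ 2 * ℕ[φ].rat z + ℕ[φ].gold z → 1 ⊑ z
1⊑ (x +φ y) p = subst (λ t → t ^ 2 ≤ 5 * y ^ 2) (sym (m≤n⇒m∸n≡0 p)) z≤n

A-positive : ∀ {i} → 1 ≤ i → 1 ≤ A i
A-positive {1} _ = s≤s z≤n
A-positive {i@(suc (suc _))} _ =
  ⌊⌋-positive (i · φ) (1⊑ (i · φ) (≤-trans (s≤s (s≤s z≤n)) (m≤n+m (i * 1) (2 * (i * 0)))))

B-positive : ∀ {i} → 1 ≤ i → 1 ≤ B i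
B-positive {i@(suc _)} _ =
  ⌊⌋-positive (i · (φ ⊗ φ)) (1⊑ (i · (φ ⊗ φ))
    (≤-trans (*-monoʳ-≤ 2 (s≤s z≤n)) (m≤m+n (2 * (i * 1)) (i * 1))))

------------------------------------------------------------------------
-- Fibonacci numbers and the set 𝒬

F : ℕ → ℕ
F 0 = 0
F 1 = 1
F (suc (suc n)) = F (suc n) + F n

-- The truncated subtraction is exact, since F (2n + 3) ≥ 2.
𝒬 : ℕ → Set
𝒬 h = (∃[ n ] (1 ≤ n × h ≡ B (B n) + 1)) ⊎ (∃[ n ] h ≡ F (2 * n + 3) ∸ 2)

------------------------------------------------------------------------
-- Normal-play partizan games

data Game : Set₁ where
  ⟨_∣_⟩ : {L R : Set} → (L → Game) → (R → Game) → Game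

-- G ≤ᴳ H iff no left option of G is ≥ H and no right option of H is ≤ G.
infix 4 _≤ᴳ_ _≈ᴳ_
_≤ᴳ_ : Game → Game → Set
G@(⟨_∣_⟩ {L} Gᴸ Gᴿ) ≤ᴳ H@(⟨_∣_⟩ {R = R} Hᴸ Hᴿ) =
  (∀ (i : L) → ¬ (H ≤ᴳ Gᴸ i)) × (∀ (j : R) → ¬ (Hᴿ j ≤ᴳ G))

-- Games have the same value when they are equal in this sense.
_≈ᴳ_ : Game → Game → Set
G ≈ᴳ H = (G ≤ᴳ H) × (H ≤ᴳ G)

-- The two kinds of move on a heap of h counters, indexed by i with the
-- numbers A i, respectively B i, of counters removed.
LeftMove RightMove : ℕ → Set
LeftMove  h = Σ[ i ∈ ℕ ] (1 ≤ i × A i ≤ h)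
RightMove h = Σ[ i ∈ ℕ ] (1 ≤ i × B i ≤ h)

heapAcc : ∀ h → Acc _<_ h → Game
heapAcc h (acc rs) =
  ⟨_∣_⟩ {LeftMove h} {RightMove h}
    (λ (i , 1≤i , Ai≤h) → heapAcc (h ∸ A i) (rs (∸-monoʳ-< (A-positive 1≤i) Ai≤h)))
    (λ (i , 1≤i , Bi≤h) → heapAcc (h ∸ B i) (rs (∸-monoʳ-< (B-positive 1≤i) Bi≤h)))

GoldenNugget : ℕ → Game
GoldenNugget h = heapAcc h (<-wellFounded h)

------------------------------------------------------------------------
-- Dyadic rationals

-- The fraction m/2ᵏ, not necessarily in lowest terms.
record Dyadic : Set where
  constructor _/2^_
  field
    numerator : ℤ
    exponent  : ℕ

toℚᵘ : Dyadic → ℚᵘ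
toℚᵘ (m /2^ k) = (m ℚᵘ./ (2 ^ k)) {{m^n≢0 2 k}}

-- 0 = { ∣ },  n + 1 = { n ∣ },  -(n + 1) = { ∣ -n }.
natGame negGame : ℕ → Game
natGame zero    = ⟨_∣_⟩ {⊥} {⊥} (λ ()) (λ ())
natGame (suc n) = ⟨_∣_⟩ {⊤} {⊥} (λ _ → natGame n) (λ ())
negGame zero    = ⟨_∣_⟩ {⊥} {⊥} (λ ()) (λ ())
negGame (suc n) = ⟨_∣_⟩ {⊥} {⊤} (λ ()) (λ _ → negGame n)

integerGame : ℤ → Game
integerGame (+ n)    = natGame n
integerGame -[1+ n ] = negGame (suc n)

-- For odd m, m/2ᵏ⁺¹ = { (m-1)/2ᵏ⁺¹ ∣ (m+1)/2ᵏ⁺¹ }, where (m-1)/2 = ⌊m/2⌋ and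
-- (m+1)/2 = ⌊m/2⌋ + 1; for even m the fraction is reduced first.
fractionGame : ℤ → ℕ → Game
fractionGame m zero = integerGame m
fractionGame m (suc k) with m %ℕ 2
... | zero  = fractionGame (m /ℕ 2) k
... | suc _ = ⟨_∣_⟩ {⊤} {⊤} (λ _ → fractionGame (m /ℕ 2) k)
                            (λ _ → fractionGame (m /ℕ 2 ℤ.+ + 1) k)

dyadicGame : Dyadic → Game
dyadicGame (m /2^ k) = fractionGame m k

------------------------------------------------------------------------
-- The map ξ

-- The binary digit dᵢ of d = d₀.d₁d₂…, namely ⌊2ⁱd⌋ mod 2 (for 0 ≤ d < 2).
digit : Dyadic → ℕ → ℕ
digit (m /2^ k) i = ((m ℤ.* + (2 ^ i)) /ℕ (2 ^ k)) {{m^n≢0 2 k}} %ℕ 2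

increment : ℕ → ℕ → ℕ
increment 0 1 = 0
increment _ _ = 2

index : (ℕ → ℕ) → ℕ → ℕ
index d 0 = 2
index d 1 = 4
index d (suc (suc i)) = index d (suc i) + increment (d i) (d (suc i))

sum≤ : ℕ → (ℕ → ℕ) → ℕ
sum≤ zero    f = f 0
sum≤ (suc k) f = sum≤ k f + f (suc k)

-- The digits of m/2ᵏ beyond the k-th vanish, so the value does not depend on
-- the fraction chosen to represent d.
ξ : Dyadic → ℕ
ξ d = sum≤ (Dyadic.exponent d) λ i → digit d i * F (index (digit d) i)

Inξ⁻¹ : ℕ → Dyadic → Set
Inξ⁻¹ h d = (ℚᵘ.½ ℚᵘ.≤ toℚᵘ d) × (toℚᵘ d ℚᵘ.≤ ℚᵘ.1ℚᵘ) × (ξ d ≡ h)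

-- d is, up to equality of rationals, the unique dyadic rational in [1/2, 1]
-- that ξ maps to h.
_isδ_ : Dyadic → ℕ → Set
d isδ h = Inξ⁻¹ h d × (∀ d′ → Inξ⁻¹ h d′ → toℚᵘ d′ ℚᵘ.≃ toℚᵘ d)

{-# OPTIONS --safe #-}

-- Attach to the heap h the number T(h) = ⌈hφ⌉ - hφ.  A heap h′ < h is a Left
-- option of h iff T(h) - T(h′) lies in (0 , φ⁻¹) modulo 1, and a Right option iff
-- T(h′) - T(h) lies in (0 , φ⁻²) modulo 1.  Since F (2j + 1) - F (2j) φ = φ⁻²ʲ, a
-- dyadic d = Σ dᵢ 2⁻ⁱ has T(ξ d) = Σ dᵢ φ^(- e i), and this is strictly increasing
-- in d: in the bisection of [0 , 1] the images of the intervals have lengths φ⁻ⁱ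
-- and split according to φ⁻ⁱ = φ⁻ⁱ⁻¹ + φ⁻ⁱ⁻².  The elements of 𝒬 ∪ {1} are the
-- heaps with φ⁻³ < T(h) ≤ φ⁻² together with the heaps F (2n + 3) - 2, which
-- approach φ⁻³ from below faster than any other heaps of their size.  By induction
-- on h ∈ 𝒬, the options of the game ξ⁻¹(h) are matched by moves to 𝒬 ∪ {1}, while
-- every other option of h is refuted by an immediate reply into 𝒬 ∪ {1}.
module Submission where

open import Defs
open import Algebra.Properties.AbelianGroup using (∙-cancelʳ)
open import Data.Empty using (⊥; ⊥-elim)
open import Data.Integer as ℤ using (ℤ; +_; -[1+_]; _/ℕ_; _%ℕ_)
import Data.Integer.Properties as ℤP
open import Data.Integer.Tactic.RingSolver using (solve-∀)
open import Data.Nat as ℕ using (ℕ; zero; suc; z≤n; s≤s; _^_; _%_; _/_)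
import Data.Nat.DivMod as DM
open import Data.Nat.Induction using (Acc; acc; <-rec; <-wellFounded)
import Data.Nat.Properties as ℕP
import Data.Nat.Tactic.RingSolver as ℕSolver
open import Data.Product using (∃-syntax; _×_; _,_; proj₁; proj₂)
open import Data.Rational.Unnormalised as ℚᵘ using (ℚᵘ)
open import Data.Sum using (_⊎_; inj₁; inj₂)
open import Data.Unit using (⊤; tt)
open import Relation.Binary.PropositionalEquality
  using (_≡_; _≢_; refl; sym; trans; cong; cong₂; subst; subst₂)
open import Relation.Nullary using (¬_; yes; no)

-- The heap and the dyadic game are compared option by option, so the options of ξ⁻¹(h) must be
-- reachable from h. Their heaps are smaller than h, because a midpoint arises from either end of
-- its interval by adding a vector with positive heap coordinate; and two points of [0 , φ⁻²] at
-- distance less than φ⁻² are always close enough for a move. The obstacle is that the left parent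
-- of a dyadic, or a Left option of h, may have its point below φ⁻³, where the induction hypothesis
-- in general says nothing. Two sides of one fact about best approximations help. Every heap with
-- its point in [0 , φ⁻³) has an exceptional heap of at most its size that is at least as close to
-- φ⁻³ and can be used in its place. And no heap smaller than an exceptional one has its point
-- between that one and φ⁻³, so smaller heaps above a good one never fall outside the set for being
-- too low. Subtracting φ⁻³ turns a heap of size k into an approximation of φ with denominator k +
-- 2; this is the origin of the -2 in F (2n + 3) - 2.

-- Games equal to dyadic rationals

module _ where
  open import Data.Nat using (_≤_; _<_; _+_; _*_)

  -- The recursive calls rotate the three games cyclically and replace one of them by an option, so
  -- the recursion terminates.
  ≤ᴳ-trans : ∀ G H K → G ≤ᴳ H → H ≤ᴳ K → G ≤ᴳ K
  ≤ᴳ-trans G@(⟨ Gᴸ ∣ _ ⟩) H@(⟨ _ ∣ _ ⟩) K@(⟨ _ ∣ Kᴿ ⟩) G≤H@(p , _) H≤K@(_ , q) =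
      (λ i K≤Gᴸ → p i (≤ᴳ-trans H K (Gᴸ i) H≤K K≤Gᴸ))
    , (λ j Kᴿ≤G → q j (≤ᴳ-trans (Kᴿ j) G H Kᴿ≤G G≤H))

  double : ℕ → ℕ
  double zero    = zero
  double (suc n) = suc (suc (double n))

  double≡*2 : ∀ n → double n ≡ n * 2
  double≡*2 zero = refl
  double≡*2 (suc n) = cong (λ t → suc (suc t)) (double≡*2 n)

  2*≡double : ∀ n → 2 * n ≡ double n
  2*≡double n = trans (ℕP.*-comm 2 n) (sym (double≡*2 n))

  double%2 : ∀ n → double n % 2 ≡ 0
  double%2 n = trans (cong (_% 2) (double≡*2 n)) (DM.m*n%n≡0 n 2)

  double/2 : ∀ n → double n / 2 ≡ n
  double/2 n = trans (cong (_/ 2) (double≡*2 n)) (DM.m*n/n≡m n 2)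

  suc-double%2 : ∀ n → suc (double n) % 2 ≡ 1
  suc-double%2 n = trans (cong (λ t → suc t % 2) (double≡*2 n)) (DM.[m+kn]%n≡m%n 1 n 2)

  suc-double/2 : ∀ n → suc (double n) / 2 ≡ n
  suc-double/2 n = trans (cong (λ t → suc t / 2) (double≡*2 n))
    (trans (DM.+-distrib-/ 1 (n * 2) (subst (λ t → suc t < 2) (sym (DM.m*n%n≡0 n 2))
        (s≤s (s≤s z≤n)))) (DM.m*n/n≡m n 2))

  data Parity : ℕ → Set where
    even : ∀ n → Parity (double n)
    odd  : ∀ n → Parity (suc (double n))

  parity : ∀ n → Parity n
  parity zero = even 0
  parity (suc n) with parity n
  ... | even m = odd m
  ... | odd m  = even (suc m)

  fracGame : ℕ → ℕ → Game
  fracGame m k = fractionGame (+ m) k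

  fracGame-even : ∀ n k → fracGame (double n) (suc k) ≡ fracGame n k
  fracGame-even n k = helper (+ double n) (double%2 n) (cong +_ (double/2 n))
    where
    helper : ∀ m {q} → m %ℕ 2 ≡ 0 → m /ℕ 2 ≡ q → fractionGame m (suc k) ≡ fractionGame q k
    helper m eq refl with m %ℕ 2 | eq
    ... | .0 | refl = refl

  fracGame-odd : ∀ n k → fracGame (suc (double n)) (suc k) ≡ ⟨_∣_⟩ {⊤} {⊤} (λ _ → fracGame n k)
      (λ _ → fracGame (suc n) k)
  fracGame-odd n k = helper (+ suc (double n)) (suc-double%2 n) (cong +_ (suc-double/2 n))
      (cong +_ (ℕP.+-comm n 1))
    where
    helper : ∀ m {q r} → m %ℕ 2 ≡ 1 → m /ℕ 2 ≡ q → q ℤ.+ + 1 ≡ r →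
      fractionGame m (suc k) ≡ ⟨_∣_⟩ {⊤} {⊤} (λ _ → fractionGame q k) (λ _ → fractionGame r k)
    helper m eq refl refl with m %ℕ 2 | eq
    ... | .1 | refl = refl

  -- The options of m/2ᵏ are (m - 1)/2ᵏ = a/2ᵇ and (m + 1)/2ᵏ = a/2ᵇ.
  LeftParent RightParent : (m k a b : ℕ) → Set
  LeftParent  m k a b = a * 2 ^ k + 2 ^ b ≡ m * 2 ^ b
  RightParent m k a b = a * 2 ^ k ≡ suc m * 2 ^ b

  -- A fraction whose game is unfolded to its options. The bound `a + b < m + k` on the parents is
  -- what the induction for `fracGame-≤` and `fracGame-≰` descends on.
  record Reduced (m k : ℕ) : Set₁ where
    field
      {L R}    : Set
      {Gᴸ}     : L → Game
      {Gᴿ}     : R → Game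
      isGame   : fracGame m k ≡ ⟨ Gᴸ ∣ Gᴿ ⟩
      left     : ∀ i → ∃[ a ] ∃[ b ] (Gᴸ i ≡ fracGame a b × LeftParent m k a b × a + b < m + k)
      right    : ∀ j → ∃[ a ] ∃[ b ] (Gᴿ j ≡ fracGame a b × RightParent m k a b × a + b < m + k)
      hasLeft  : 0 < m → L
      hasRight : 0 < k → R

  double-≤ : ∀ n → n ≤ double n
  double-≤ zero = z≤n
  double-≤ (suc n) = s≤s (ℕP.m≤n⇒m≤1+n (double-≤ n))

  Halvable : ℕ → ℕ → Set
  Halvable m k = ∃[ n ] ∃[ j ] (m ≡ double n × k ≡ suc j)

  reduced? : ∀ m k → Reduced m k ⊎ Halvable m k
  reduced? zero zero = inj₁ record
    { isGame = refl ; left = λ () ; right = λ () ; hasLeft = λ () ; hasRight = λ () }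
  reduced? (suc n) zero = inj₁ record
    { isGame = refl ; left = λ _ → n , 0 , refl , trans (ℕP.+-comm (n * 1) 1) refl , ℕP.≤-refl
    ; right = λ () ; hasLeft = λ _ → tt ; hasRight = λ () }
  reduced? m (suc k) with parity m
  ... | even n = inj₂ (n , k , refl , refl)
  ... | odd n = inj₁ record
    { isGame = fracGame-odd n k
    ; left   = λ _ → n , k , refl , trans (e₁ n (2 ^ k))
        (cong (λ t → suc t * 2 ^ k) (sym (double≡*2 n))) , s≤s smaller
    ; right  = λ _ → suc n , k , refl , trans (e₂ n (2 ^ k))
        (cong (λ t → suc (suc t) * 2 ^ k) (sym (double≡*2 n)))
               , s≤s (subst (suc (n + k) ≤_) (sym (ℕP.+-suc (double n) k))
                   (s≤s (ℕP.+-monoˡ-≤ k (double-≤ n))))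
    ; hasLeft = λ _ → tt ; hasRight = λ _ → tt }
    where
    e₁ : ∀ n p → n * (2 * p) + p ≡ suc (n * 2) * p
    e₁ = ℕSolver.solve-∀
    e₂ : ∀ n p → suc n * (2 * p) ≡ suc (suc (n * 2)) * p
    e₂ = ℕSolver.solve-∀
    smaller : n + k ≤ double n + suc k
    smaller = ℕP.+-mono-≤ (double-≤ n) (ℕP.n≤1+n k)

  -- Transitivity of the order on the fractions p/2ᵈ, q/2ᵉ and r/2ᶠ.
  private
    swap : ∀ x y z → x * y * z ≡ x * z * y
    swap = ℕSolver.solve-∀

  cross-<-≤ : ∀ p q r d e f → p * 2 ^ e < q * 2 ^ d → q * 2 ^ f ≤ r * 2 ^ e → p * 2 ^ f < r * 2 ^ d
  cross-<-≤ p q r d e f p<q q≤r = ℕP.*-cancelʳ-< (2 ^ e) _ _ (begin-strict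
    p * 2 ^ f * 2 ^ e ≡⟨ swap p (2 ^ f) (2 ^ e) ⟩
    p * 2 ^ e * 2 ^ f <⟨ ℕP.*-monoˡ-< (2 ^ f) {{ℕP.m^n≢0 2 f}} p<q ⟩
    q * 2 ^ d * 2 ^ f ≡⟨ swap q (2 ^ d) (2 ^ f) ⟩
    q * 2 ^ f * 2 ^ d ≤⟨ ℕP.*-monoˡ-≤ (2 ^ d) q≤r ⟩
    r * 2 ^ e * 2 ^ d ≡⟨ swap r (2 ^ e) (2 ^ d) ⟩
    r * 2 ^ d * 2 ^ e ∎)
    where open ℕP.≤-Reasoning

  cross-≤-< : ∀ p q r d e f → p * 2 ^ e ≤ q * 2 ^ d → q * 2 ^ f < r * 2 ^ e → p * 2 ^ f < r * 2 ^ d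
  cross-≤-< p q r d e f p≤q q<r = ℕP.*-cancelʳ-< (2 ^ e) _ _ (begin-strict
    p * 2 ^ f * 2 ^ e ≡⟨ swap p (2 ^ f) (2 ^ e) ⟩
    p * 2 ^ e * 2 ^ f ≤⟨ ℕP.*-monoˡ-≤ (2 ^ f) p≤q ⟩
    q * 2 ^ d * 2 ^ f ≡⟨ swap q (2 ^ d) (2 ^ f) ⟩
    q * 2 ^ f * 2 ^ d <⟨ ℕP.*-monoˡ-< (2 ^ d) {{ℕP.m^n≢0 2 d}} q<r ⟩
    r * 2 ^ e * 2 ^ d ≡⟨ swap r (2 ^ e) (2 ^ d) ⟩
    r * 2 ^ d * 2 ^ e ∎)
    where open ℕP.≤-Reasoning

  LeftParent-< : ∀ m k a b → LeftParent m k a b → a * 2 ^ k < m * 2 ^ b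
  LeftParent-< m k a b eq = subst (a * 2 ^ k <_) eq (ℕP.m<m+n _ (ℕP.m^n>0 2 b))

  RightParent-< : ∀ m k a b → RightParent m k a b → m * 2 ^ b < a * 2 ^ k
  RightParent-< m k a b eq = subst (m * 2 ^ b <_) (sym eq) (ℕP.m<n+m _ (ℕP.m^n>0 2 b))

  -- Over the common denominator `2 ^ (k + t)` the numerators are integers that differ by at least
  -- 1, so taking one unit off the larger fraction does not overtake the smaller one.
  ≤-LeftParent : ∀ m k t m′ a b → m * 2 ^ (k + t) < m′ * 2 ^ k → LeftParent m′ (k + t) a b → m * 2 ^
      b ≤ a * 2 ^ k
  ≤-LeftParent m k t m′ a b m<m′ eq = ℕP.*-cancelʳ-≤ _ _ (2 ^ t) {{ℕP.m^n≢0 2 t}}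
      (ℕP.+-cancelʳ-≤ (2 ^ b) _ _ (begin
    m * 2 ^ b * 2 ^ t + 2 ^ b     ≡⟨ e₁ m (2 ^ b) (2 ^ t) ⟩
    suc (m * 2 ^ t) * 2 ^ b       ≤⟨ ℕP.*-monoˡ-≤ (2 ^ b) (ℕP.*-cancelʳ-< (2 ^ k) (m * 2 ^ t) m′
        (subst (_< m′ * 2 ^ k) e₂ m<m′)) ⟩
    m′ * 2 ^ b                    ≡⟨ sym eq ⟩
    a * 2 ^ (k + t) + 2 ^ b       ≡⟨ cong (_+ 2 ^ b) (trans (cong (a *_) (ℕP.^-distribˡ-+-* 2 k t))
        (sym (ℕP.*-assoc a (2 ^ k) (2 ^ t)))) ⟩
    a * 2 ^ k * 2 ^ t + 2 ^ b     ∎))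
    where
    open ℕP.≤-Reasoning
    e₁ : ∀ m b t → m * b * t + b ≡ suc (m * t) * b
    e₁ = ℕSolver.solve-∀
    e₂ : m * 2 ^ (k + t) ≡ m * 2 ^ t * 2 ^ k
    e₂ = trans (cong (m *_) (ℕP.^-distribˡ-+-* 2 k t))
        (trans (sym (ℕP.*-assoc m (2 ^ k) (2 ^ t))) (swap m (2 ^ k) (2 ^ t)))

  RightParent-≤ : ∀ m k t m′ a b → m * 2 ^ k < m′ * 2 ^ (k + t) → RightParent m (k + t) a b → a * 2
      ^ k ≤ m′ * 2 ^ b
  RightParent-≤ m k t m′ a b m<m′ eq = ℕP.*-cancelʳ-≤ _ _ (2 ^ t) {{ℕP.m^n≢0 2 t}} (begin
    a * 2 ^ k * 2 ^ t   ≡⟨ trans (ℕP.*-assoc a (2 ^ k) (2 ^ t))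
        (cong (a *_) (sym (ℕP.^-distribˡ-+-* 2 k t))) ⟩
    a * 2 ^ (k + t)     ≡⟨ eq ⟩
    suc m * 2 ^ b       ≤⟨ ℕP.*-monoˡ-≤ (2 ^ b) (ℕP.*-cancelʳ-< (2 ^ k) m (m′ * 2 ^ t)
        (subst (m * 2 ^ k <_) e m<m′)) ⟩
    m′ * 2 ^ t * 2 ^ b  ≡⟨ swap m′ (2 ^ t) (2 ^ b) ⟩
    m′ * 2 ^ b * 2 ^ t  ∎)
    where
    open ℕP.≤-Reasoning
    e : m′ * 2 ^ (k + t) ≡ m′ * 2 ^ t * 2 ^ k
    e = trans (cong (m′ *_) (ℕP.^-distribˡ-+-* 2 k t))
        (trans (sym (ℕP.*-assoc m′ (2 ^ k) (2 ^ t))) (swap m′ (2 ^ k) (2 ^ t)))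

  private
    halve-left : ∀ n k′ → double n * 2 ^ k′ ≡ n * 2 ^ k′ * 2
    halve-left n k′ = trans (cong (_* 2 ^ k′) (double≡*2 n)) (swap n 2 (2 ^ k′))
    halve-right : ∀ (m′ j : ℕ) → m′ * 2 ^ suc j ≡ m′ * 2 ^ j * 2
    halve-right m′ j = e m′ (2 ^ j)
      where
      e : ∀ m p → m * (2 * p) ≡ m * p * 2
      e = ℕSolver.solve-∀
    halved : ∀ (n j : ℕ) → n + j < double n + suc j
    halved n j = subst (n + j <_) (sym (ℕP.+-suc _ j)) (s≤s (ℕP.+-monoˡ-≤ j (double-≤ n)))

  fracGame-≤ : ∀ s m k m′ k′ → m + k + (m′ + k′) < s → m * 2 ^ k′ ≤ m′ * 2 ^ k → fracGame m k ≤ᴳ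
      fracGame m′ k′
  -- Of two distinct fractions, the one with the larger exponent has an option weakly between them:
  -- a Left option if it is the greater one, a Right option if it is the smaller one. Between equal
  -- exponents the Left option is taken, since integers have no Right option.
  fracGame-≰ : ∀ s m k m′ k′ → m + k + (m′ + k′) < s → m * 2 ^ k′ < m′ * 2 ^ k → ¬
      (fracGame m′ k′ ≤ᴳ fracGame m k)

  fracGame-≤ (suc s) m k m′ k′ (s≤s bound) le with reduced? m k | reduced? m′ k′
  ... | inj₂ (n , j , refl , refl) | _ = subst (_≤ᴳ fracGame m′ k′) (sym (fracGame-even n j))
    (fracGame-≤ s n j m′ k′ (ℕP.<-≤-trans (ℕP.+-monoˡ-< (m′ + k′) (halved n j)) bound)
      (ℕP.*-cancelʳ-≤ _ _ 2 (subst₂ _≤_ (halve-left n k′) (halve-right m′ j) le)))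
  ... | inj₁ _ | inj₂ (n , j , refl , refl) = subst (fracGame m k ≤ᴳ_) (sym (fracGame-even n j))
    (fracGame-≤ s m k n j (ℕP.<-≤-trans (ℕP.+-monoʳ-< (m + k) (halved n j)) bound)
      (ℕP.*-cancelʳ-≤ _ _ 2 (subst₂ _≤_ (halve-right m j) (halve-left n k) le)))
  ... | inj₁ x | inj₁ y = subst₂ _≤ᴳ_ (sym X.isGame) (sym Y.isGame) (lefts , rights)
    where
    module X = Reduced x
    module Y = Reduced y
    lefts : ∀ i → ¬ (⟨ Y.Gᴸ ∣ Y.Gᴿ ⟩ ≤ᴳ X.Gᴸ i)
    lefts i y≤xᴸ with a , b , eq , parent , a+b< ← X.left i =
      fracGame-≰ s a b m′ k′ (ℕP.<-≤-trans (ℕP.+-monoˡ-< (m′ + k′) a+b<) bound)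
        (cross-<-≤ a m m′ b k k′ (LeftParent-< m k a b parent) le)
            (subst₂ _≤ᴳ_ (sym Y.isGame) eq y≤xᴸ)
    rights : ∀ j → ¬ (Y.Gᴿ j ≤ᴳ ⟨ X.Gᴸ ∣ X.Gᴿ ⟩)
    rights j yᴿ≤x with a , b , eq , parent , a+b< ← Y.right j =
      fracGame-≰ s m k a b (ℕP.<-≤-trans (ℕP.+-monoʳ-< (m + k) a+b<) bound)
        (cross-≤-< m m′ a k k′ b le (RightParent-< m′ k′ a b parent))
            (subst₂ _≤ᴳ_ eq (sym X.isGame) yᴿ≤x)

  fracGame-≰ (suc s) m k m′ k′ (s≤s bound) lt y≤x with reduced? m k | reduced? m′ k′
  ... | inj₂ (n , j , refl , refl) | _ =
    fracGame-≰ s n j m′ k′ (ℕP.<-≤-trans (ℕP.+-monoˡ-< (m′ + k′) (halved n j)) bound)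
      (ℕP.*-cancelʳ-< 2 _ _ (subst₂ _<_ (halve-left n k′) (halve-right m′ j) lt))
      (subst (fracGame m′ k′ ≤ᴳ_) (fracGame-even n j) y≤x)
  ... | inj₁ _ | inj₂ (n , j , refl , refl) =
    fracGame-≰ s m k n j (ℕP.<-≤-trans (ℕP.+-monoʳ-< (m + k) (halved n j)) bound)
      (ℕP.*-cancelʳ-< 2 _ _ (subst₂ _<_ (halve-right m j) (halve-left n k) lt))
      (subst (_≤ᴳ fracGame m k) (fracGame-even n j) y≤x)
  ... | inj₁ x | inj₁ y with subst₂ _≤ᴳ_ (Reduced.isGame y) (Reduced.isGame x) y≤x | k ℕ.≤? k′
  ...   | lefts , _ | yes k≤k′ with t , refl ← ℕP.m≤n⇒∃[o]m+o≡n k≤k′ =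
    let module X = Reduced x
        module Y = Reduced y
        i = Y.hasLeft (ℕP.n≢0⇒n>0 λ { refl → ℕP.n≮0 lt })
        a , b , eq , parent , a+b< = Y.left i
    in lefts i (subst₂ _≤ᴳ_ X.isGame (sym eq)
         (fracGame-≤ s m k a b (ℕP.<-≤-trans (ℕP.+-monoʳ-< (m + k) a+b<) bound)
             (≤-LeftParent m k t m′ a b lt parent)))
  ...   | _ , rights | no k≰k′ with t , refl ← ℕP.m≤n⇒∃[o]m+o≡n (ℕP.<⇒≤ (ℕP.≰⇒> k≰k′)) =
    let module X = Reduced x
        module Y = Reduced y
        j = X.hasRight (ℕP.≤-<-trans z≤n (ℕP.≰⇒> k≰k′))
        a , b , eq , parent , a+b< = X.right j
    in rights j (subst₂ _≤ᴳ_ (sym eq) Y.isGame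
         (fracGame-≤ s a b m′ k′ (ℕP.<-≤-trans (ℕP.+-monoˡ-< (m′ + k′) a+b<) bound)
             (RightParent-≤ m k′ t m′ a b lt parent)))

  fractionGame-mono : ∀ m k m′ k′ → m * 2 ^ k′ ≤ m′ * 2 ^ k → fractionGame (+ m) k ≤ᴳ fractionGame
      (+ m′) k′
  fractionGame-mono m k m′ k′ = fracGame-≤ _ m k m′ k′ ℕP.≤-refl

  fractionGame-strict : ∀ m k m′ k′ → m * 2 ^ k′ < m′ * 2 ^ k → ¬
      (fractionGame (+ m′) k′ ≤ᴳ fractionGame (+ m) k)
  fractionGame-strict m k m′ k′ = fracGame-≰ _ m k m′ k′ ℕP.≤-refl

open import Data.Integer using (_+_; _-_; _*_; -_)

-- The order of ℤ[φ]

-- Pos x y says x + yφ > 0: multiplying by φ turns x + yφ into y + (x + y)φ, and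
-- a positive number has nonnegative coordinates after finitely many such steps.
data Pos : ℤ → ℤ → Set where
  rat⁺  : ∀ {a b} → Pos (+ suc a) (+ b)
  gold⁺ : ∀ {a b} → Pos (+ a) (+ suc b)
  ÷φ    : ∀ {x y} → Pos y (x + y) → Pos x y

cast : ∀ {x y x′ y′} → x ≡ x′ → y ≡ y′ → Pos x y → Pos x′ y′
cast refl refl p = p

·φ : ∀ {x y} → Pos x y → Pos y (x + y)
·φ (rat⁺ {b = zero})  = gold⁺
·φ (rat⁺ {b = suc _}) = rat⁺
·φ gold⁺  = rat⁺
·φ (÷φ p) = p

private
  interchange : ∀ x y x′ y′ → (x + x′) + (y + y′) ≡ (x + y) + (x′ + y′)
  interchange = solve-∀

-- Both summands are multiplied by φ until the second has nonnegative coordinates too; the first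
-- keeps nonnegative coordinates on the way, though its nonzero one may change place.
+-rat⁺  : ∀ {a b x y} → Pos x y → Pos (+ suc a + x) (+ b + y)
+-gold⁺ : ∀ {a b x y} → Pos x y → Pos (+ a + x) (+ suc b + y)
+-rat⁺ rat⁺  = rat⁺
+-rat⁺ gold⁺ = rat⁺
+-rat⁺ {a} {zero} (÷φ {x} {y} p)  = ÷φ (cast refl (sym (interchange (+ suc a) (+ 0) x y))
    (+-gold⁺ {0} {a ℕ.+ 0} p))
+-rat⁺ {a} {suc b} (÷φ {x} {y} p) = ÷φ (cast refl (sym (interchange (+ suc a) (+ suc b) x y))
    (+-rat⁺ p))
+-gold⁺ {a} {b} rat⁺ = cast (cong +_ (sym (ℕP.+-suc a _))) refl rat⁺
+-gold⁺ gold⁺ = gold⁺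
+-gold⁺ {a} {b} (÷φ {x} {y} p) = ÷φ (cast refl (sym (interchange (+ a) (+ suc b) x y))
   (subst (λ t → Pos (+ suc b + y) (+ t + (x + y))) (sym (ℕP.+-suc a b)) (+-rat⁺ p)))

infixl 6 _⊕_
_⊕_ : ∀ {x y x′ y′} → Pos x y → Pos x′ y′ → Pos (x + x′) (y + y′)
rat⁺  ⊕ q = +-rat⁺ q
gold⁺ ⊕ q = +-gold⁺ q
÷φ {x} {y} p ⊕ q = ÷φ (cast refl (sym (interchange x y _ _)) (p ⊕ ·φ q))

¬Pos00 : ∀ {x y} → Pos x y → x ≡ + 0 → y ≡ + 0 → ⊥
¬Pos00 rat⁺ ()
¬Pos00 gold⁺ _ ()
¬Pos00 (÷φ p) refl refl = ¬Pos00 p refl refl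

Pos-asym : ∀ {x y} → Pos x y → ¬ Pos (- x) (- y)
Pos-asym {x} {y} p q = ¬Pos00 (p ⊕ q) (ℤP.+-inverseʳ x) (ℤP.+-inverseʳ y)

-- The sign of a - bφ, found by Euclid's algorithm, agrees with the sign of its
-- norm a² - ab - b².
SignByNorm : ℕ → ℕ → Set
SignByNorm a b =
    (Pos (+ a) (- + b) × a ℕ.* b ℕ.+ b ℕ.* b ℕ.< a ℕ.* a)
  ⊎ (a ≡ 0 × b ≡ 0)
  ⊎ (Pos (- + a) (+ b) × a ℕ.* a ℕ.< a ℕ.* b ℕ.+ b ℕ.* b)

-- One Euclidean step is (a - bφ)φ = -(b - (a - b)φ). It flips the sign, and it flips the sign of
-- the norm as well, because φ has norm -1.
sign-by-norm : ∀ a b → SignByNorm a b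
sign-by-norm = <-rec (λ a → ∀ b → SignByNorm a b) go
  where
  neg₁ : ∀ x y → - (x + y) + x ≡ - y
  neg₁ = solve-∀
  neg₂ : ∀ x y → (x + y) + - x ≡ y
  neg₂ = solve-∀
  neg₃ : ∀ x y → - x + (x + y) ≡ y
  neg₃ = solve-∀
  sq₁ : ∀ b c → (b ℕ.+ c) ℕ.* (b ℕ.+ c) ≡ (b ℕ.* c ℕ.+ c ℕ.* c) ℕ.+ (b ℕ.* c ℕ.+ b ℕ.* b)
  sq₁ = ℕSolver.solve-∀
  sq₂ : ∀ b c → (b ℕ.+ c) ℕ.* b ℕ.+ b ℕ.* b ≡ b ℕ.* b ℕ.+ (b ℕ.* c ℕ.+ b ℕ.* b)
  sq₂ = ℕSolver.solve-∀
  go : ∀ a → (∀ {a′} → a′ ℕ.< a → ∀ b → SignByNorm a′ b) → ∀ b → SignByNorm a b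
  go zero rec zero = inj₂ (inj₁ (refl , refl))
  go zero rec (suc b) = inj₂ (inj₂ (gold⁺ , s≤s z≤n))
  go (suc a) rec zero = inj₁ (rat⁺ , subst (ℕ._< suc a ℕ.* suc a)
      (sym (trans (ℕP.+-identityʳ _) (ℕP.*-zeroʳ a))) (s≤s z≤n))
  go a@(suc _) rec b@(suc _) with a ℕ.≤? b
  ... | yes a≤b with k , refl ← ℕP.m≤n⇒∃[o]m+o≡n a≤b =
    inj₂ (inj₂ ( ÷φ (subst (Pos (+ b)) (sym (neg₃ (+ a) (+ k))) rat⁺)
               , ℕP.≤-<-trans (ℕP.*-monoʳ-≤ a a≤b) (ℕP.m<m+n _ (s≤s z≤n))))
  ... | no a≰b with k , refl ← ℕP.m≤n⇒∃[o]m+o≡n (ℕP.<⇒≤ (ℕP.≰⇒> a≰b)) | rec (ℕP.≰⇒> a≰b) k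
  ...   | inj₁ (p , n) = inj₂ (inj₂ (÷φ (subst (Pos (+ b)) (sym (neg₁ (+ b) (+ k))) p)
            , subst₂ ℕ._<_ (sym (sq₁ b k)) (sym (sq₂ b k)) (ℕP.+-monoˡ-< _ n)))
  ...   | inj₂ (inj₂ (p , n)) = inj₁ (÷φ (subst (Pos (- + b)) (sym (neg₂ (+ b) (+ k))) p)
            , subst₂ ℕ._<_ (sym (sq₂ b k)) (sym (sq₁ b k)) (ℕP.+-monoˡ-< _ n))

sign : ∀ x y → Pos x y ⊎ (x ≡ + 0 × y ≡ + 0) ⊎ Pos (- x) (- y)
sign (+ zero)  (+ zero)  = inj₂ (inj₁ (refl , refl))
sign (+ zero)  (+ suc _) = inj₁ gold⁺
sign (+ suc _) (+ _)     = inj₁ rat⁺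
sign (+ a)     -[1+ b ]  with sign-by-norm a (suc b)
... | inj₁ (p , _)        = inj₁ p
... | inj₂ (inj₂ (p , _)) = inj₂ (inj₂ p)
sign -[1+ a ]  (+ b)     with sign-by-norm (suc a) b
... | inj₁ (p , _)        = inj₂ (inj₂ p)
... | inj₂ (inj₂ (p , _)) = inj₁ p
sign -[1+ _ ]  -[1+ _ ]  = inj₂ (inj₂ rat⁺)

¬Pos-nonpos : ∀ a b → ¬ Pos (- + a) (- + b)
¬Pos-nonpos zero    zero    p = ¬Pos00 p refl refl
¬Pos-nonpos zero    (suc b) p = Pos-asym p gold⁺
¬Pos-nonpos (suc a) b       p = Pos-asym (rat⁺ {a} {b}) p

¬Pos-≤0 : ∀ {x y} → x ℤ.≤ + 0 → y ℤ.≤ + 0 → ¬ Pos x y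
¬Pos-≤0 {+ zero} {+ zero} _ _ p = ¬Pos00 p refl refl
¬Pos-≤0 {+ zero} { -[1+ b ]} _ _ p = ¬Pos-nonpos 0 (suc b) p
¬Pos-≤0 { -[1+ a ]} {+ zero} _ _ p = ¬Pos-nonpos (suc a) 0 p
¬Pos-≤0 { -[1+ a ]} { -[1+ b ]} _ _ p = ¬Pos-nonpos (suc a) (suc b) p
¬Pos-≤0 {+ suc _} (ℤ.+≤+ ())
¬Pos-≤0 {_} {+ suc _} _ (ℤ.+≤+ ())

-- Floors: the inequality `⊑` in terms of norms.

module _ (x a y : ℕ) where
  private
    excess : 2 ℕ.* (x ℕ.+ a) ℕ.∸ (2 ℕ.* x ℕ.+ y) ≡ 2 ℕ.* a ℕ.∸ y
    excess = trans (cong (ℕ._∸ (2 ℕ.* x ℕ.+ y)) (ℕP.*-distribˡ-+ 2 x a))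
        (ℕP.[m+n]∸[m+o]≡n∸o (2 ℕ.* x) (2 ℕ.* a) y)

    -- Completing the square: four times either side of the norm inequality contains y² + 2yr, and
    -- what remains is r² against 5y².
    square-of-excess : ∀ r → 2 ℕ.* a ≡ y ℕ.+ r →
      (4 ℕ.* (a ℕ.* a) ≡ (y ℕ.* y ℕ.+ 2 ℕ.* (y ℕ.* r)) ℕ.+ r ℕ.^ 2)
      × (4 ℕ.* (a ℕ.* y ℕ.+ y ℕ.* y) ≡ (y ℕ.* y ℕ.+ 2 ℕ.* (y ℕ.* r)) ℕ.+ 5 ℕ.* y ℕ.^ 2)
    square-of-excess r eq =
        trans (e₁ a) (trans (cong₂ ℕ._*_ eq eq) (e₂ y r))
      , trans (e₃ a y) (trans (cong (λ t → 2 ℕ.* (t ℕ.* y) ℕ.+ 4 ℕ.* (y ℕ.* y)) eq) (e₄ y r))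
      where
      e₁ : ∀ a → 4 ℕ.* (a ℕ.* a) ≡ (2 ℕ.* a) ℕ.* (2 ℕ.* a)
      e₁ = ℕSolver.solve-∀
      e₂ : ∀ y r → (y ℕ.+ r) ℕ.* (y ℕ.+ r) ≡ (y ℕ.* y ℕ.+ 2 ℕ.* (y ℕ.* r)) ℕ.+ r ℕ.* (r ℕ.* 1)
      e₂ = ℕSolver.solve-∀
      e₃ : ∀ a y → 4 ℕ.* (a ℕ.* y ℕ.+ y ℕ.* y) ≡ 2 ℕ.* ((2 ℕ.* a) ℕ.* y) ℕ.+ 4 ℕ.* (y ℕ.* y)
      e₃ = ℕSolver.solve-∀
      e₄ : ∀ y r → 2 ℕ.* ((y ℕ.+ r) ℕ.* y) ℕ.+ 4 ℕ.* (y ℕ.* y) ≡ (y ℕ.* y ℕ.+ 2 ℕ.* (y ℕ.* r)) ℕ.+ 5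
          ℕ.* (y ℕ.* (y ℕ.* 1))
      e₄ = ℕSolver.solve-∀

  ⊑⇒norm : (x ℕ.+ a) ⊑ (x +φ y) → a ℕ.* a ℕ.≤ a ℕ.* y ℕ.+ y ℕ.* y
  ⊑⇒norm p with ℕP.≤-total (2 ℕ.* a) y
  ... | inj₁ 2a≤y = ℕP.≤-trans (ℕP.*-monoʳ-≤ a (ℕP.≤-trans (ℕP.m≤m+n a _) 2a≤y)) (ℕP.m≤m+n _ _)
  ... | inj₂ y≤2a with r , eq ← ℕP.m≤n⇒∃[o]m+o≡n y≤2a with e₁ , e₂ ← square-of-excess r (sym eq) =
    ℕP.*-cancelˡ-≤ 4 (subst₂ ℕ._≤_ (sym e₁) (sym e₂) (ℕP.+-monoʳ-≤ (y ℕ.* y ℕ.+ 2 ℕ.* (y ℕ.* r))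
      (subst (λ t → t ℕ.^ 2 ℕ.≤ 5 ℕ.* y ℕ.^ 2)
        (trans excess (trans (cong (ℕ._∸ y) (sym eq)) (ℕP.m+n∸m≡n y r))) p)))

  norm⇒⊑ : a ℕ.* a ℕ.≤ a ℕ.* y ℕ.+ y ℕ.* y → (x ℕ.+ a) ⊑ (x +φ y)
  norm⇒⊑ p with ℕP.≤-total (2 ℕ.* a) y
  ... | inj₁ 2a≤y = subst (λ t → t ℕ.^ 2 ℕ.≤ 5 ℕ.* y ℕ.^ 2)
      (sym (trans excess (ℕP.m≤n⇒m∸n≡0 2a≤y))) z≤n
  ... | inj₂ y≤2a with r , eq ← ℕP.m≤n⇒∃[o]m+o≡n y≤2a with e₁ , e₂ ← square-of-excess r (sym eq) =
    subst (λ t → t ℕ.^ 2 ℕ.≤ 5 ℕ.* y ℕ.^ 2)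
      (sym (trans excess (trans (cong (ℕ._∸ y) (sym eq)) (ℕP.m+n∸m≡n y r))))
      (ℕP.+-cancelˡ-≤ (y ℕ.* y ℕ.+ 2 ℕ.* (y ℕ.* r)) _ _ (subst₂ ℕ._≤_ e₁ e₂ (ℕP.*-monoʳ-≤ 4 p)))

private
  drop : ∀ (k o : ℕ) → (+ k - + (k ℕ.+ o)) ≡ - + o
  drop k o = e (+ k) (+ o)
    where
    e : ∀ k o → k - (k + o) ≡ - o
    e = solve-∀
  rise : ∀ (x a : ℕ) → + (x ℕ.+ a) - + x ≡ + a
  rise x a = e (+ x) (+ a)
    where
    e : ∀ x a → (x + a) - x ≡ a
    e = solve-∀

⊑⇒¬Pos : ∀ k x y → k ⊑ (x +φ y) → ¬ Pos (+ k - + x) (- + y)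
⊑⇒¬Pos k x y p q with ℕP.≤-total k x
... | inj₁ k≤x with o , refl ← ℕP.m≤n⇒∃[o]m+o≡n k≤x = ¬Pos-nonpos o y (cast (drop k o) refl q)
... | inj₂ x≤k with a , refl ← ℕP.m≤n⇒∃[o]m+o≡n x≤k with sign-by-norm a y
...   | inj₁ (_ , n) = ℕP.<⇒≱ n (⊑⇒norm x a y p)
...   | inj₂ (inj₁ (refl , refl)) = ¬Pos-nonpos 0 0 (cast (rise x 0) refl q)
...   | inj₂ (inj₂ (r , _)) = Pos-asym q (cast (cong -_ (sym (rise x a)))
    (sym (ℤP.neg-involutive (+ y))) r)

¬⊑⇒Pos : ∀ k x y → ¬ (k ⊑ (x +φ y)) → Pos (+ k - + x) (- + y)
¬⊑⇒Pos k x y ¬p with ℕP.≤-total k x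
... | inj₁ k≤x = ⊥-elim (¬p (subst (λ t → t ℕ.^ 2 ℕ.≤ 5 ℕ.* y ℕ.^ 2)
                   (sym (ℕP.m≤n⇒m∸n≡0 (ℕP.≤-trans (ℕP.*-monoʳ-≤ 2 k≤x) (ℕP.m≤m+n (2 ℕ.* x) y))))
                       z≤n))
... | inj₂ x≤k with a , refl ← ℕP.m≤n⇒∃[o]m+o≡n x≤k with sign-by-norm a y
...   | inj₁ (r , _) = cast (sym (rise x a)) refl r
...   | inj₂ (inj₁ (refl , refl)) = ⊥-elim (¬p (norm⇒⊑ x 0 0 z≤n))
...   | inj₂ (inj₂ (_ , n)) = ⊥-elim (¬p (norm⇒⊑ x a y (ℕP.<⇒≤ n)))

Pos-suc⇒0≤ : ∀ x → Pos (+ 1 + x) (+ 0) → + 0 ℤ.≤ x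
Pos-suc⇒0≤ (+ _) _ = ℤ.+≤+ z≤n
Pos-suc⇒0≤ -[1+ zero ] p = ⊥-elim (¬Pos-nonpos 0 0 p)
Pos-suc⇒0≤ -[1+ suc a ] p = ⊥-elim (¬Pos-nonpos (suc a) 0 p)

-- a = ⌊x + yφ⌋; both inequalities are strict, as x + yφ is irrational for y ≥ 1.
IsFloor : ℕ → ℕ → ℕ → Set
IsFloor a x y = Pos (+ x - + a) (+ y) × Pos (+ suc a - + x) (- + y)

⌊⌋-isFloor : ∀ x y → 1 ℕ.≤ y → IsFloor ⌊ x +φ y ⌋ x y
⌊⌋-isFloor x y@(suc _) _ = low (sign (+ x - + a) (+ y)) , ¬⊑⇒Pos (suc a) x y (⌊⌋-upper (x +φ y))
  where
  a = ⌊ x +φ y ⌋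
  flip : ∀ x a → - (x - a) ≡ a - x
  flip = solve-∀
  low : _ → Pos (+ x - + a) (+ y)
  low (inj₁ p) = p
  low (inj₂ (inj₂ p)) = ⊥-elim (⊑⇒¬Pos a x y (⌊⌋-lower (x +φ y)) (cast (flip (+ x) (+ a)) refl p))

IsFloor-unique : ∀ {a b x y} → IsFloor a x y → IsFloor b x y → a ≡ b
IsFloor-unique {a} {b} {x} {y} (p , q) (p′ , q′) = ℕP.≤-antisym (half p q′) (half p′ q)
  where
  e₁ : ∀ a b x → (x - a) + ((+ 1 + b) - x) ≡ + 1 + (b - a)
  e₁ = solve-∀
  half : ∀ {a b} → Pos (+ x - + a) (+ y) → Pos (+ suc b - + x) (- + y) → a ℕ.≤ b
  half {a} {b} p q = ℤP.drop‿+≤+ (ℤP.0≤i-j⇒j≤i (Pos-suc⇒0≤ (+ b - + a)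
    (cast (e₁ (+ a) (+ b) (+ x)) (ℤP.+-inverseʳ (+ y)) (p ⊕ q))))

A-isFloor : ∀ n → 1 ℕ.≤ n → IsFloor (A n) 0 n
A-isFloor n 1≤n = subst₂ (IsFloor (A n)) (ℕP.*-zeroʳ n) (ℕP.*-identityʳ n)
  (⌊⌋-isFloor (n ℕ.* 0) (n ℕ.* 1) (subst (1 ℕ.≤_) (sym (ℕP.*-identityʳ n)) 1≤n))

B-isFloor : ∀ n → 1 ℕ.≤ n → IsFloor (B n) n n
B-isFloor n 1≤n = subst₂ (IsFloor (B n)) (ℕP.*-identityʳ n) (ℕP.*-identityʳ n)
  (⌊⌋-isFloor (n ℕ.* 1) (n ℕ.* 1) (subst (1 ℕ.≤_) (sym (ℕP.*-identityʳ n)) 1≤n))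

-- Points, and moves as distances between them.

-- (c , h) stands for the real number c - hφ.  For a heap h the relevant c is
-- ⌈hφ⌉, so that the number is 1 minus the fractional part of hφ.
Point : Set
Point = ℤ × ℤ

infix 4 _≺_ _≼_
record _≺_ (P Q : Point) : Set where
  constructor [_]
  field pos : Pos (proj₁ Q - proj₁ P) (proj₂ P - proj₂ Q)

_≼_ : Point → Point → Set
P ≼ Q = P ≺ Q ⊎ P ≡ Q

infixl 6 _⊹_
_⊹_ : Point → Point → Point
(c , h) ⊹ (c′ , h′) = c + c′ , h + h′

O φ⁻¹ φ⁻² φ⁻³ φ⁻⁴ : Point
O   = + 0 , + 0
φ⁻¹ = -[1+ 0 ] , -[1+ 0 ]
φ⁻² = + 2 , + 1
φ⁻³ = -[1+ 2 ] , -[1+ 1 ]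
φ⁻⁴ = + 5 , + 3

private
  telescope : ∀ x y z → (y - x) + (z - y) ≡ z - x
  telescope = solve-∀
  telescope′ : ∀ x y z → (x - y) + (y - z) ≡ x - z
  telescope′ = solve-∀
  translate : ∀ x y z → y - x ≡ (y + z) - (x + z)
  translate = solve-∀
  neg-minus : ∀ x y → - (x - y) ≡ y - x
  neg-minus = solve-∀

≺-trans : ∀ {P Q R} → P ≺ Q → Q ≺ R → P ≺ R
≺-trans {c , h} {c′ , h′} {c″ , h″} [ p ] [ q ] = [ cast (telescope c c′ c″) (telescope′ h h′ h″)
    (p ⊕ q) ]

≺-irrefl : ∀ {P} → ¬ (P ≺ P)
≺-irrefl {c , h} [ p ] = ¬Pos00 p (ℤP.+-inverseʳ c) (ℤP.+-inverseʳ h)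

≺-asym : ∀ {P Q} → P ≺ Q → ¬ (Q ≺ P)
≺-asym p q = ≺-irrefl (≺-trans p q)

≺-≼-trans : ∀ {P Q R} → P ≺ Q → Q ≼ R → P ≺ R
≺-≼-trans p (inj₁ q) = ≺-trans p q
≺-≼-trans p (inj₂ refl) = p

≼-≺-trans : ∀ {P Q R} → P ≼ Q → Q ≺ R → P ≺ R
≼-≺-trans (inj₁ p) q = ≺-trans p q
≼-≺-trans (inj₂ refl) q = q

≼-trans : ∀ {P Q R} → P ≼ Q → Q ≼ R → P ≼ R
≼-trans (inj₁ p) q = inj₁ (≺-≼-trans p q)
≼-trans (inj₂ refl) q = q

≼⇒⊁ : ∀ {P Q} → P ≼ Q → ¬ (Q ≺ P)
≼⇒⊁ p q = ≺-irrefl (≼-≺-trans p q)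

≺-shift : ∀ V {P Q} → P ≺ Q → P ⊹ V ≺ Q ⊹ V
≺-shift (g , n) {c , h} {c′ , h′} [ p ] = [ cast (translate c c′ g) (translate h′ h n) p ]

≺-unshift : ∀ V {P Q} → P ⊹ V ≺ Q ⊹ V → P ≺ Q
≺-unshift (g , n) {c , h} {c′ , h′} [ p ] = [ cast (sym (translate c c′ g))
    (sym (translate h′ h n)) p ]

≼-shift : ∀ V {P Q} → P ≼ Q → P ⊹ V ≼ Q ⊹ V
≼-shift V (inj₁ p) = inj₁ (≺-shift V p)
≼-shift V (inj₂ refl) = inj₂ refl

≼-unshift : ∀ V {P Q} → P ⊹ V ≼ Q ⊹ V → P ≼ Q
≼-unshift V (inj₁ p) = inj₁ (≺-unshift V p)
≼-unshift (g , n) {c , h} {c′ , h′} (inj₂ eq) = inj₂ (cong₂ _,_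
  (∙-cancelʳ ℤP.+-0-abelianGroup g c c′ (cong proj₁ eq))
      (∙-cancelʳ ℤP.+-0-abelianGroup n h h′ (cong proj₂ eq)))

compare : ∀ P Q → P ≺ Q ⊎ P ≡ Q ⊎ Q ≺ P
compare (c , h) (c′ , h′) with sign (c′ - c) (h - h′)
... | inj₁ p = inj₁ [ p ]
... | inj₂ (inj₁ (p , q)) = inj₂ (inj₁ (cong₂ _,_ (sym (ℤP.i-j≡0⇒i≡j c′ c p))
    (ℤP.i-j≡0⇒i≡j h h′ q)))
... | inj₂ (inj₂ p) = inj₂ (inj₂ [ cast (neg-minus c′ c) (neg-minus h h′) p ])

≼⊎≻ : ∀ P Q → P ≼ Q ⊎ Q ≺ P
≼⊎≻ P Q with compare P Q
... | inj₁ p = inj₁ (inj₁ p)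
... | inj₂ (inj₁ p) = inj₁ (inj₂ p)
... | inj₂ (inj₂ p) = inj₂ p

O≺φ⁻⁴ : O ≺ φ⁻⁴
O≺φ⁻⁴ = [ ÷φ (÷φ (÷φ (÷φ rat⁺))) ]
φ⁻⁴≺φ⁻³ : φ⁻⁴ ≺ φ⁻³
φ⁻⁴≺φ⁻³ = [ ÷φ (÷φ (÷φ (÷φ (÷φ rat⁺)))) ]
φ⁻³≺φ⁻² : φ⁻³ ≺ φ⁻²
φ⁻³≺φ⁻² = [ ÷φ (÷φ (÷φ (÷φ rat⁺))) ]
φ⁻²≺φ⁻¹ : φ⁻² ≺ φ⁻¹
φ⁻²≺φ⁻¹ = [ ÷φ (÷φ (÷φ rat⁺)) ]

-- A move of n counters is described by the integer g with n = A i, g = i + n,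
-- respectively n = B i, g = 2n - i; then g - nφ lies in (0 , 1/φ), respectively
-- in (-1/φ² , 0).
A-move : ∀ {c h c′ h′} → h′ ℕ.≤ h → (c′ , + h′) ≺ (c , + h) → (c , + h) ≺ (c′ , + h′) ⊹ φ⁻¹ →
  ∃[ i ] (1 ℕ.≤ i × A i ℕ.+ h′ ≡ h)
A-move {c} {h} {c′} {h′} h′≤h [ p ] [ q ] with n , refl ← ℕP.m≤n⇒∃[o]m+o≡n h′≤h =
  conclude ((c - c′) - + n) (cast (e₁ (+ h′) (+ n)) (e₂ c c′ (+ h′) (+ n)) (·φ p))
                            (cast (e₃ (+ h′) (+ n)) (e₄ c c′ (+ h′) (+ n)) (·φ q))
  where
  e₁ : ∀ h n → h - (h + n) ≡ + 0 - n
  e₁ = solve-∀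
  e₂ : ∀ c c′ h n → (c - c′) + (h - (h + n)) ≡ (c - c′) - n
  e₂ = solve-∀
  e₃ : ∀ h n → (h + n) - (h + -[1+ 0 ]) ≡ (+ 1 + n) - + 0
  e₃ = solve-∀
  e₄ : ∀ c c′ h n → ((c′ + -[1+ 0 ]) - c) + ((h + n) - (h + -[1+ 0 ])) ≡ - ((c - c′) - n)
  e₄ = solve-∀
  conclude : ∀ i → Pos (+ 0 - + n) i → Pos (+ suc n - + 0) (- i) → ∃[ i ]
      (1 ℕ.≤ i × A i ℕ.+ h′ ≡ h′ ℕ.+ n)
  conclude (+ suc i) p q = suc i , s≤s z≤n ,
    trans (cong (ℕ._+ h′) (IsFloor-unique (A-isFloor (suc i) (s≤s z≤n)) (p , q))) (ℕP.+-comm n h′)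
  conclude (+ zero) p q = ⊥-elim (¬Pos-nonpos n 0 (cast (ℤP.+-identityˡ (- + n)) refl p))
  conclude -[1+ i ] p q = ⊥-elim (¬Pos-nonpos n (suc i) (cast (ℤP.+-identityˡ (- + n)) refl p))

B-move : ∀ {c h c′ h′} → h′ ℕ.≤ h → (c , + h) ≺ (c′ , + h′) → (c′ , + h′) ≺ (c , + h) ⊹ φ⁻² →
  ∃[ i ] (1 ℕ.≤ i × B i ℕ.+ h′ ≡ h)
B-move {c} {h} {c′} {h′} h′≤h [ p ] [ q ] with n , refl ← ℕP.m≤n⇒∃[o]m+o≡n h′≤h =
  conclude (+ 2 * + n - (c - c′)) (cast (e₁ c c′ (+ h′) (+ n)) (e₂ c c′ (+ h′) (+ n)) (·φ (·φ p)))
                            (cast (e₃ c c′ (+ h′) (+ n)) (e₄ c c′ (+ h′) (+ n)) (·φ (·φ q)))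
  where
  e₁ : ∀ c c′ h n → (c′ - c) + ((h + n) - h) ≡ (+ 2 * n - (c - c′)) - n
  e₁ = solve-∀
  e₂ : ∀ c c′ h n → ((h + n) - h) + ((c′ - c) + ((h + n) - h)) ≡ + 2 * n - (c - c′)
  e₂ = solve-∀
  e₃ : ∀ c c′ h n → ((c + + 2) - c′) + (h - (h + n + + 1)) ≡ (+ 1 + n) - (+ 2 * n - (c - c′))
  e₃ = solve-∀
  e₄ : ∀ c c′ h n → (h - (h + n + + 1)) + (((c + + 2) - c′) + (h - (h + n + + 1))) ≡
      - (+ 2 * n - (c - c′))
  e₄ = solve-∀
  conclude : ∀ i → Pos (i - + n) i → Pos (+ suc n - i) (- i) → ∃[ i ]
      (1 ℕ.≤ i × B i ℕ.+ h′ ≡ h′ ℕ.+ n)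
  conclude (+ suc i) p q = suc i , s≤s z≤n ,
    trans (cong (ℕ._+ h′) (IsFloor-unique (B-isFloor (suc i) (s≤s z≤n)) (p , q))) (ℕP.+-comm n h′)
  conclude i@(+ zero) p q = ⊥-elim (¬Pos-≤0 (ℤP.i≤j⇒i-j≤0 {i} {+ n} (ℤ.+≤+ z≤n)) (ℤ.+≤+ z≤n) p)
  conclude i@(-[1+ _ ]) p q = ⊥-elim (¬Pos-≤0 (ℤP.i≤j⇒i-j≤0 {i} {+ n} ℤ.-≤+) ℤ.-≤+ p)

A-move⁻¹ : ∀ c {h i} → 1 ℕ.≤ i → A i ℕ.≤ h →
  ∃[ c′ ] ((c′ , + (h ℕ.∸ A i)) ≺ (c , + h) × (c , + h) ≺ (c′ , + (h ℕ.∸ A i)) ⊹ φ⁻¹)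
A-move⁻¹ c {h} {i} 1≤i Ai≤h with k , eq ← ℕP.m≤n⇒∃[o]m+o≡n Ai≤h | A-isFloor i 1≤i
... | p , q rewrite sym eq | ℕP.m+n∸m≡n (A i) k =
      c - (+ i + + n)
    , [ ÷φ (cast (e₁ (+ n) (+ k)) (e₂ c (+ i) (+ n) (+ k)) p) ]
    , [ ÷φ (cast (e₃ (+ n) (+ k)) (e₄ c (+ i) (+ n) (+ k)) q) ]
  where
  n = A i
  e₁ : ∀ n k → + 0 - n ≡ k - (n + k)
  e₁ = solve-∀
  e₂ : ∀ c i n k → i ≡ (c - (c - (i + n))) + (k - (n + k))
  e₂ = solve-∀
  e₃ : ∀ n k → (+ 1 + n) - + 0 ≡ (n + k) - (k + -[1+ 0 ])
  e₃ = solve-∀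
  e₄ : ∀ c i n k → - i ≡ (((c - (i + n)) + -[1+ 0 ]) - c) + ((n + k) - (k + -[1+ 0 ]))
  e₄ = solve-∀

B-move⁻¹ : ∀ c {h i} → 1 ℕ.≤ i → B i ℕ.≤ h →
  ∃[ c′ ] ((c , + h) ≺ (c′ , + (h ℕ.∸ B i)) × (c′ , + (h ℕ.∸ B i)) ≺ (c , + h) ⊹ φ⁻²)
B-move⁻¹ c {h} {i} 1≤i Bi≤h with k , eq ← ℕP.m≤n⇒∃[o]m+o≡n Bi≤h | B-isFloor i 1≤i
... | p , q rewrite sym eq | ℕP.m+n∸m≡n (B i) k =
      c - (+ 2 * + n - + i)
    , [ ÷φ (÷φ (cast (e₁ c (+ i) (+ n) (+ k)) (e₂ c (+ i) (+ n) (+ k)) p)) ]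
    , [ ÷φ (÷φ (cast (e₃ c (+ i) (+ n) (+ k)) (e₄ c (+ i) (+ n) (+ k)) q)) ]
  where
  n = B i
  e₁ : ∀ c i n k → i - n ≡ ((c - (+ 2 * n - i)) - c) + ((n + k) - k)
  e₁ = solve-∀
  e₂ : ∀ c i n k → i ≡ ((n + k) - k) + (((c - (+ 2 * n - i)) - c) + ((n + k) - k))
  e₂ = solve-∀
  e₃ : ∀ c i n k → (+ 1 + n) - i ≡ ((c + + 2) - (c - (+ 2 * n - i))) + (k - (n + k + + 1))
  e₃ = solve-∀
  e₄ : ∀ c i n k → - i ≡ (k - (n + k + + 1)) + (((c + + 2) - (c - (+ 2 * n - i)))
      + (k - (n + k + + 1)))
  e₄ = solve-∀

-- Rational approximations of φ

bφ<a⇒b<a : ∀ a b → Pos (+ a) (- + b) → b ℕ.< a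
bφ<a⇒b<a a b p with a ℕ.≤? b
... | no a≰b = ℕP.≰⇒> a≰b
... | yes a≤b = ⊥-elim (¬Pos-≤0 (ℤP.neg-≤-pos {b} {0}) (ℤP.i≤j⇒i-j≤0 (ℤ.+≤+ a≤b)) (·φ p))

a<bφ⇒a<2b : ∀ a b → Pos (- + a) (+ b) → a ℕ.< 2 ℕ.* b
a<bφ⇒a<2b a b p with 2 ℕ.* b ℕ.≤? a
... | no ≰ = ℕP.≰⇒> ≰
... | yes 2b≤a = ⊥-elim (¬Pos-≤0
    (subst (ℤ._≤ + 0) (ℤP.+-comm (+ b) (- + a))
        (ℤP.i≤j⇒i-j≤0 {+ b} {+ a} (ℤ.+≤+ (ℕP.≤-trans (ℕP.m≤m+n b _) 2b≤a))))
    (subst (ℤ._≤ + 0) (e (+ a) (+ b)) (ℤP.i≤j⇒i-j≤0 (ℤ.+≤+ 2b≤a)))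
    (·φ (·φ p)))
  where
  e : ∀ a b → (b + (b + + 0)) - a ≡ b + (- a + b)
  e = solve-∀

Fᵉ Fᵒ : ℕ → ℕ
Fᵉ n = F (double n)
Fᵒ n = F (suc (double n))

Fᵒ-positive : ∀ n → 1 ℕ.≤ Fᵒ n
Fᵒ-positive zero = s≤s z≤n
Fᵒ-positive (suc n) = ℕP.≤-trans (Fᵒ-positive n) (ℕP.m≤n+m _ _)

Fᵒ-increasing : ∀ {m n} → m ℕ.≤ n → Fᵒ m ℕ.≤ Fᵒ n
Fᵒ-increasing {n = n} z≤n = Fᵒ-positive n
Fᵒ-increasing {suc m} {suc n} (s≤s m≤n) = ℕP.+-mono-≤
    (ℕP.+-mono-≤ (Fᵒ-increasing m≤n) (Fᵉ-increasing m≤n)) (Fᵒ-increasing m≤n)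
  where
  Fᵉ-increasing : ∀ {m n} → m ℕ.≤ n → Fᵉ m ℕ.≤ Fᵉ n
  Fᵉ-increasing z≤n = z≤n
  Fᵉ-increasing (s≤s m≤n) = ℕP.+-mono-≤ (Fᵒ-increasing m≤n) (Fᵉ-increasing m≤n)

Fᵒ-<-suc : ∀ n → Fᵒ n ℕ.< Fᵒ (suc n)
Fᵒ-<-suc n = ℕP.m<n+m (Fᵒ n) (ℕP.≤-trans (Fᵒ-positive n) (ℕP.m≤m+n _ _))

-- The numbers φ⁻²ⁿ and -φ⁻⁽²ⁿ⁺¹⁾.
evenPower oddPower : ℕ → Point
evenPower n = + Fᵒ n , + Fᵉ n
oddPower  n = + Fᵉ (suc n) , + Fᵒ n

O≺even : ∀ n → O ≺ evenPower n
O≺even zero = [ rat⁺ ]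
O≺even (suc n) with [ p ] ← O≺even n =
  [ ÷φ (÷φ (cast (e₁ (+ Fᵒ n) (+ Fᵉ n)) (e₂ (+ Fᵒ n) (+ Fᵉ n)) p)) ]
  where
  e₁ : ∀ a b → a - + 0 ≡ ((a + b) + a - + 0) + (+ 0 - (a + b))
  e₁ = solve-∀
  e₂ : ∀ a b → + 0 - b ≡ (+ 0 - (a + b)) + (((a + b) + a - + 0) + (+ 0 - (a + b)))
  e₂ = solve-∀

odd≺O : ∀ n → oddPower n ≺ O
odd≺O n with [ p ] ← O≺even n =
  [ ÷φ (cast refl (e (+ Fᵒ n) (+ Fᵉ n)) p) ]
  where
  e : ∀ a b → + 0 - b ≡ (+ 0 - (a + b)) + (a - + 0)
  e = solve-∀

odd≺odd-suc : ∀ n → oddPower n ≺ oddPower (suc n)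
odd≺odd-suc n with [ p ] ← O≺even (suc n) =
  [ cast (e₁ (+ Fᵉ (suc n)) (+ Fᵒ n)) (e₂ (+ Fᵉ (suc n)) (+ Fᵒ n)) p ]
  where
  e₁ : ∀ a b → (a + b) - + 0 ≡ ((a + b) + a) - a
  e₁ = solve-∀
  e₂ : ∀ a b → + 0 - a ≡ b - (a + b)
  e₂ = solve-∀

odd-increasing : ∀ {m n} → m ℕ.≤ n → oddPower m ≼ oddPower n
odd-increasing {m} {n} m≤n with ℕP.m≤n⇒m<n∨m≡n m≤n
... | inj₂ refl = inj₂ refl
odd-increasing {m} {suc n} _ | inj₁ (s≤s m≤n) = inj₁
    (≼-≺-trans (odd-increasing m≤n) (odd≺odd-suc n))

-- Among the N ≥ 1 with M < Nφ, the odd-indexed Fibonacci numbers set the records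
-- for the distance Nφ - M.
Record : ℕ → ℕ → Set
Record M N = ∃[ n ] (Fᵒ n ℕ.≤ N × Fᵉ (suc n) ℕ.≤ M × (+ M , + N) ≼ oddPower n)

-- Dividing M - Nφ by φ² gives (2M + N) - (M + N)φ and carries `oddPower n` to `oddPower (suc n)`.
Record-÷φ² : ∀ {M N} → Record M N → Record (M ℕ.+ N ℕ.+ M) (M ℕ.+ N)
Record-÷φ² {M} {N} (n , p , q , r) = suc n
  , ℕP.+-mono-≤ q p
  , ℕP.+-mono-≤ (ℕP.+-mono-≤ q p) q
  , below r
  where
  e₁ : ∀ a b M N → a - M ≡ ((a + b + a) - (M + N + M)) + ((M + N) - (a + b))
  e₁ = solve-∀
  e₂ : ∀ a b M N → N - b ≡ ((M + N) - (a + b)) + (((a + b + a) - (M + N + M)) + ((M + N) - (a + b)))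
  e₂ = solve-∀
  below : (+ M , + N) ≼ oddPower n → (+ (M ℕ.+ N ℕ.+ M) , + (M ℕ.+ N)) ≼ oddPower (suc n)
  below (inj₂ refl) = inj₂ refl
  below (inj₁ [ p ]) = inj₁ [ ÷φ (÷φ (cast (e₁ (+ Fᵉ (suc n)) (+ Fᵒ n) (+ M) (+ N))
      (e₂ (+ Fᵉ (suc n)) (+ Fᵒ n) (+ M) (+ N)) p)) ]

-- Descent by φ². The hypotheses say 0 < Nφ - M < φ. If the distance is at least φ⁻¹, index 0 works;
-- otherwise multiplication by φ² gives a smaller pair whose distance is again below φ, as φ⁻¹φ² =
-- φ.
record-approximation : ∀ s M N → M ℕ.+ N ℕ.≤ s → 1 ℕ.≤ N →
  Pos (- + M) (+ N) → Pos (+ M) (- (+ N - + 1)) → Record M N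
record-approximation zero M (suc N) M+N≤0 _ _ _ = ⊥-elim
    (ℕP.m+1+n≰m 0 (ℕP.≤-trans (ℕP.m≤n+m _ M) M+N≤0))
record-approximation (suc s) zero (suc N₀) _ _ p q = ⊥-elim (ℕP.n≮0 (bφ<a⇒b<a 0 N₀ q))
record-approximation (suc s) M@(suc M₀) N@(suc N₀) M+N≤s 1≤N p q with ≼⊎≻ (+ M , + N) (oddPower 0)
... | inj₁ le = 0 , s≤s z≤n , s≤s z≤n , le
... | inj₂ [ r ] = subst₂ Record (trans (cong (ℕ._+ M′) eqN) eqM) eqN
        (Record-÷φ² (record-approximation s M′ N′
          (ℕP.≤-pred (ℕP.≤-trans (ℕ.s≤s (ℕP.≤-reflexive eqN))
              (ℕP.≤-trans (ℕP.m≤n+m (suc N) M₀)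
              (ℕP.≤-trans (ℕP.≤-reflexive (ℕP.+-suc M₀ N)) M+N≤s))))
          (ℕP.m<n⇒0<n∸m M<2N)
          (cast (c₁ (+ M′) (+ N′)) (c₂ (+ M′) (+ N′))
              (·φ (·φ (subst₂ (λ x y → Pos (- x) y) zM zN p))))
          (cast (c₃ (+ M′) (+ N′)) (c₄ (+ M′) (+ N′))
              (·φ (·φ (subst₂ (λ x y → Pos (x - + 1) (+ 1 - y)) zM zN r))))))
  where
  e₀ : ∀ n → + 1 - (+ 1 + n) ≡ - n
  e₀ = solve-∀
  N<M : N ℕ.< M
  N<M = s≤s (bφ<a⇒b<a M₀ N₀ (cast refl (e₀ (+ N₀)) r))
  M<2N : M ℕ.< 2 ℕ.* N
  M<2N = a<bφ⇒a<2b M N p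
  M′ = M ℕ.∸ N
  N′ = 2 ℕ.* N ℕ.∸ M
  eqM : N ℕ.+ M′ ≡ M
  eqM = ℕP.m+[n∸m]≡n (ℕP.<⇒≤ N<M)
  eqN : M′ ℕ.+ N′ ≡ N
  eqN = ℕP.+-cancelˡ-≡ N _ _ (trans (sym (ℕP.+-assoc N M′ N′))
      (trans (cong (ℕ._+ N′) eqM) (trans (ℕP.m+[n∸m]≡n (ℕP.<⇒≤ M<2N))
      (cong (N ℕ.+_) (ℕP.+-identityʳ N)))))
  zM : + M ≡ + M′ + + N′ + + M′
  zM = cong +_ (sym (trans (cong (ℕ._+ M′) eqN) eqM))
  zN : + N ≡ + M′ + + N′
  zN = cong +_ (sym eqN)
  c₁ : ∀ m n → - (m + n + m) + (m + n) ≡ - m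
  c₁ = solve-∀
  c₂ : ∀ m n → (m + n) + (- (m + n + m) + (m + n)) ≡ n
  c₂ = solve-∀
  c₃ : ∀ m n → (m + n + m - + 1) + (+ 1 - (m + n)) ≡ m
  c₃ = solve-∀
  c₄ : ∀ m n → (+ 1 - (m + n)) + ((m + n + m - + 1) + (+ 1 - (m + n))) ≡ - (n - + 1)
  c₄ = solve-∀

best-approximation : ∀ M N → 1 ℕ.≤ N → oddPower 0 ≺ (M , + N) → (M , + N) ≺ O →
  ∃[ n ] (Fᵒ n ℕ.≤ N × (M , + N) ≼ oddPower n)
best-approximation M N@(suc N₀) 1≤N [ t ] [ q ] = conclude M q
    (cast (e₁ M) (e₂ (+ N₀)) (t ⊕ rat⁺ {0} {0}))
  where
  e₁ : ∀ M → (M - + 1) + + 1 ≡ M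
  e₁ = solve-∀
  e₂ : ∀ n → (+ 1 - (+ 1 + n)) + + 0 ≡ - n
  e₂ = solve-∀
  e₃ : ∀ n → - n ≡ - (+ 1 + n - + 1)
  e₃ = solve-∀
  conclude : ∀ M → Pos (+ 0 - M) (+ N - + 0) → Pos M (- + N₀) → ∃[ n ]
      (Fᵒ n ℕ.≤ N × (M , + N) ≼ oddPower n)
  conclude -[1+ m ] _ r = ⊥-elim (¬Pos-nonpos (suc m) N₀ r)
  conclude (+ m) q r with record-approximation (m ℕ.+ N) m N ℕP.≤-refl 1≤N
         (cast (ℤP.+-identityˡ (- + m)) (ℤP.+-identityʳ (+ N)) q) (cast refl (e₃ (+ N₀)) r)
  ... | n , Fᵒn≤N , _ , le = n , Fᵒn≤N , le

no-better-approximation : ∀ n M N → 1 ℕ.≤ N → oddPower n ≺ (M , + N) → (M , + N) ≺ O → Fᵒ n ℕ.< N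
no-better-approximation n M N 1≤N lower upper
  with n′ , Fᵒn′≤N , le ← best-approximation M N 1≤N (≼-≺-trans (odd-increasing {n = n} z≤n) lower)
      upper
  with n′ ℕ.≤? n
... | yes n′≤n = ⊥-elim (≺-irrefl (≺-≼-trans lower (≼-trans le (odd-increasing n′≤n))))
... | no n′≰n = ℕP.<-≤-trans (Fᵒ-<-suc n) (ℕP.≤-trans (Fᵒ-increasing (ℕP.≰⇒> n′≰n)) Fᵒn′≤N)

-- The set 𝒬

-φ⁻³ : Point
-φ⁻³ = + 3 , + 2

-- The elements of 𝒬 ∪ {1}: the points of (φ⁻³ , φ⁻²] and the exceptional heaps
-- F (2n + 3) - 2, whose points φ⁻³ - φ⁻⁽²ⁿ⁺³⁾ approach φ⁻³ from below.
data Good (c : ℤ) (h : ℕ) : Set where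
  window      : φ⁻³ ≺ (c , + h) → (c , + h) ≼ φ⁻² → Good c h
  exceptional : ∀ n → (c , + h) ⊹ -φ⁻³ ≡ oddPower (suc n) → Good c h

exceptional≺φ⁻³ : ∀ {P} n → P ⊹ -φ⁻³ ≡ oddPower (suc n) → P ≺ φ⁻³
exceptional≺φ⁻³ n eq = ≺-unshift -φ⁻³ (subst (_≺ O) (sym eq) (odd≺O (suc n)))

Good⇒≼φ⁻² : ∀ {c h} → Good c h → (c , + h) ≼ φ⁻²
Good⇒≼φ⁻² (window _ p) = p
Good⇒≼φ⁻² (exceptional n eq) = inj₁ (≺-trans (exceptional≺φ⁻³ n eq) φ⁻³≺φ⁻²)

Good⇒O≼ : ∀ {c h} → Good c h → O ≼ (c , + h)
Good⇒O≼ (window p _) = inj₁ (≺-trans (≺-trans O≺φ⁻⁴ φ⁻⁴≺φ⁻³) p)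
Good⇒O≼ (exceptional n eq) = ≼-unshift -φ⁻³ (subst (O ⊹ -φ⁻³ ≼_) (sym eq)
    (odd-increasing {1} {suc n} (s≤s z≤n)))

-- Equality is excluded because `φ⁻³` has heap coordinate -2.
above-φ⁻³ : ∀ {c k} → ¬ ((c , + k) ≺ φ⁻³) → φ⁻³ ≺ (c , + k)
above-φ⁻³ {c} {k} ¬p with compare (c , + k) φ⁻³
... | inj₁ p = ⊥-elim (¬p p)
... | inj₂ (inj₂ p) = p

size-of-exceptional : ∀ {c h} n → (c , + h) ⊹ -φ⁻³ ≡ oddPower (suc n) → h ℕ.+ 2 ≡ Fᵒ (suc n)
size-of-exceptional n eq = ℤP.+-injective (cong proj₂ eq)

-- A point between an exceptional one and φ⁻³ would, after subtracting φ⁻³, be a better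
-- approximation with denominator k + 2 than the record with denominator h + 2, although k < h.
Good-above : ∀ {c h c′ k} → Good c h → k ℕ.< h →
  (c , + h) ≺ (c′ , + k) → (c′ , + k) ≼ φ⁻² → Good c′ k
Good-above {c} {h} {c′} {k} g k<h p q = window (above-φ⁻³ (below g)) q
  where
  below : Good c h → ¬ ((c′ , + k) ≺ φ⁻³)
  below (window r _) s = ≺-asym (≺-trans r p) s
  below (exceptional n eq) s = ℕP.<-asym (ℕP.+-monoˡ-< 2 k<h)
      (subst (ℕ._< k ℕ.+ 2) (sym (size-of-exceptional {c} n eq))
    (no-better-approximation (suc n) (c′ + + 3) (k ℕ.+ 2) (ℕP.≤-trans (s≤s z≤n) (ℕP.m≤n+m 2 k))
      (subst (_≺ (c′ , + k) ⊹ -φ⁻³) eq (≺-shift -φ⁻³ p)) (≺-shift -φ⁻³ s)))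

exceptional-point : ∀ n → (+ Fᵉ (suc (suc n)) - + 3 , + (Fᵒ (suc n) ℕ.∸ 2)) ⊹ -φ⁻³ ≡ oddPower
    (suc n)
exceptional-point n = cong₂ _,_ (e (+ Fᵉ (suc (suc n))))
    (cong +_ (ℕP.m∸n+n≡m (Fᵒ-increasing {1} {suc n} (s≤s z≤n))))
  where
  e : ∀ a → (a - + 3) + + 3 ≡ a
  e = solve-∀

-- After subtracting φ⁻³, the record that bounds the distance of this point is itself the point of
-- an exceptional heap. The record of index 0 does not occur, since the distance to φ⁻³ is at most
-- φ⁻³ < φ⁻¹.
exceptional-below : ∀ {c k} → O ≼ (c , + k) → (c , + k) ≺ φ⁻³ →
  ∃[ n ] ∃[ c′ ] ∃[ e ] ((c′ , + e) ⊹ -φ⁻³ ≡ oddPower (suc n) × e ℕ.≤ k × (c , + k) ≼ (c′ , + e))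
exceptional-below {c} {k} p q
  with best-approximation (c + + 3) (k ℕ.+ 2) (ℕP.≤-trans (s≤s z≤n) (ℕP.m≤n+m 2 k))
         (≺-≼-trans (odd≺odd-suc 0) (≼-shift -φ⁻³ p)) (≺-shift -φ⁻³ q)
... | zero , _ , le = ⊥-elim (≺-irrefl (≼-≺-trans (≼-trans (≼-shift -φ⁻³ p) le) (odd≺odd-suc 0)))
... | suc n , Fᵒ≤k+2 , le = n , + Fᵉ (suc (suc n)) - + 3 , Fᵒ (suc n) ℕ.∸ 2 , eq
      , ℕP.m≤n+o⇒m∸n≤o (Fᵒ (suc n)) 2 (subst (Fᵒ (suc n) ℕ.≤_) (ℕP.+-comm k 2) Fᵒ≤k+2)
      , ≼-unshift -φ⁻³ (subst ((c , + k) ⊹ -φ⁻³ ≼_) (sym eq) le)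
  where
  eq = exceptional-point n

-- Above φ⁻³ the heap k is good itself; below, `exceptional-below` supplies a substitute. If h is
-- exceptional too, the smaller of the two heaps has the smaller index and so lies farther below
-- φ⁻³.
Good-below : ∀ {c h c′ k} → Good c h → k ℕ.< h → O ≼ (c′ , + k) → (c′ , + k) ≺ (c , + h) →
  ∃[ c″ ] ∃[ e ] (Good c″ e × e ℕ.≤ k × (c′ , + k) ≼ (c″ , + e) × (c″ , + e) ≺ (c , + h))
Good-below {c} {h} {c′} {k} g k<h p q with compare (c′ , + k) φ⁻³
... | inj₂ (inj₂ r) = c′ , k , window r (≼-trans (inj₁ q) (Good⇒≼φ⁻² g)) , ℕP.≤-refl , inj₂ refl , q
... | inj₁ r with n , c″ , e , eq , e≤k , le ← exceptional-below p r =
  c″ , e , exceptional n eq , e≤k , le , before g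
  where
  before : Good c h → (c″ , + e) ≺ (c , + h)
  before (window s _) = ≺-trans (exceptional≺φ⁻³ n eq) s
  before (exceptional n′ eq′) with suc n′ ℕ.≤? suc n
  ... | yes n′≤n = ⊥-elim (ℕP.<⇒≱ (ℕP.+-monoˡ-< 2 (ℕP.≤-<-trans e≤k k<h))
        (subst₂ ℕ._≤_ (sym (size-of-exceptional {c} n′ eq′)) (sym (size-of-exceptional {c″} n eq))
            (Fᵒ-increasing n′≤n)))
  ... | no n′≰n = ≺-unshift -φ⁻³ (subst₂ _≺_ (sym eq) (sym eq′)
        (≺-≼-trans (odd≺odd-suc (suc n)) (odd-increasing (ℕP.≰⇒> n′≰n))))

-- Since φ⁻¹ = φ⁻² + φ⁻³, failure would put the point of k, shifted by φ⁻¹, strictly between that of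
-- h and φ⁻³, against the record property. This lets Right answer a Left option below `O` with the
-- empty heap.
Good-near-O : ∀ {c h c′ k} → Good c h → k ℕ.< h → (c , + h) ≺ (c′ , + k) ⊹ φ⁻¹ → O ≺ (c′ , + k)
    ⊹ φ⁻²
Good-near-O {c} {h} {c′} {k} g k<h p with compare O ((c′ , + k) ⊹ φ⁻²)
... | inj₁ q = q
... | inj₂ (inj₁ q) = ⊥-elim (ℕP.m+1+n≢0 k (sym (ℤP.+-injective (cong proj₂ q))))
... | inj₂ (inj₂ q) = ⊥-elim (absurd g)
  where
  absurd : Good c h → ⊥
  absurd (window r _) = ≺-asym q (≺-unshift φ⁻³ (subst (φ⁻³ ≺_)
    (cong₂ _,_ (sym (ℤP.+-assoc c′ (+ 2) -[1+ 2 ])) (sym (ℤP.+-assoc (+ k) (+ 1) -[1+ 1 ])))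
        (≺-trans r p)))
  absurd (exceptional n eq) = ℕP.<-asym (ℕP.+-monoˡ-< 2 k<h)
    (ℕP.<-≤-trans (subst (ℕ._< k ℕ.+ 1) (sym (size-of-exceptional {c} n eq))
      (no-better-approximation (suc n) (c′ + + 2) (k ℕ.+ 1) (ℕP.m≤n+m 1 k)
        (subst₂ _≺_ eq (cong₂ _,_ (ℤP.+-assoc c′ -[1+ 0 ] (+ 3)) (ℤP.+-assoc (+ k) -[1+ 0 ] (+ 2)))
            (≺-shift -φ⁻³ p))
        q))
      (ℕP.+-monoʳ-≤ k (s≤s z≤n)))

-- The map ξ

half-increment : ℕ → ℕ → ℕ
half-increment 0 1 = 0
half-increment _ _ = 1

-- For d = m/2ᵏ the index e (k + 1) is 2 (I m k + 1), the value ξ d is H m k, and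
-- C m k is the same sum with every Fibonacci index raised by 1, so that
-- C m k - H m k φ = Σ dᵢ φ^(- e i).
I H C : ℕ → ℕ → ℕ
I m zero    = 1
I m (suc k) = I (m / 2) k ℕ.+ half-increment ((m / 2) % 2) (m % 2)
H m zero    = m % 2
H m (suc k) = H (m / 2) k ℕ.+ (m % 2) ℕ.* Fᵉ (suc (I (m / 2) k))
C m zero    = (m % 2) ℕ.* 2
C m (suc k) = C (m / 2) k ℕ.+ (m % 2) ℕ.* Fᵒ (suc (I (m / 2) k))

point : ℕ → ℕ → Point
point m k = + C m k , + H m k

I-even : ∀ n k → I (double n) (suc k) ≡ suc (I n k)
I-even n k rewrite double%2 n | double/2 n = trans (cong (I n k ℕ.+_) (e (n % 2)))
    (ℕP.+-comm (I n k) 1)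
  where
  e : ∀ a → half-increment a 0 ≡ 1
  e zero    = refl
  e (suc _) = refl

I-odd : ∀ n k → I (suc (double n)) (suc k) ≡ I n k ℕ.+ half-increment (n % 2) 1
I-odd n k rewrite suc-double%2 n | suc-double/2 n = refl

H-even : ∀ n k → H (double n) (suc k) ≡ H n k
H-even n k rewrite double%2 n | double/2 n = ℕP.+-identityʳ _

C-even : ∀ n k → C (double n) (suc k) ≡ C n k
C-even n k rewrite double%2 n | double/2 n = ℕP.+-identityʳ _

H-odd : ∀ n k → H (suc (double n)) (suc k) ≡ H n k ℕ.+ Fᵉ (suc (I n k))
H-odd n k rewrite suc-double%2 n | suc-double/2 n = cong (H n k ℕ.+_) (ℕP.*-identityˡ _)

C-odd : ∀ n k → C (suc (double n)) (suc k) ≡ C n k ℕ.+ Fᵒ (suc (I n k))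
C-odd n k rewrite suc-double%2 n | suc-double/2 n = cong (C n k ℕ.+_) (ℕP.*-identityˡ _)

point-even : ∀ n k → point (double n) (suc k) ≡ point n k
point-even n k = cong₂ (λ c h → + c , + h) (C-even n k) (H-even n k)

-- The distance between the points of m/2ᵏ and (m + 1)/2ᵏ depends on the last
-- digit of m: it is φ^(-2i) or φ^(-2i-1) for i = I m k.
data Gap (m k : ℕ) : Set where
  gap₀ : m % 2 ≡ 0 → C (suc m) k ≡ C m k ℕ.+ Fᵒ (I m k) → H (suc m) k ≡ H m k ℕ.+ Fᵉ (I m k) →
      Gap m k
  gap₁ : m % 2 ≡ 1 → C m k ≡ C (suc m) k ℕ.+ Fᵉ (suc (I m k)) → H m k ≡ H (suc m) k ℕ.+ Fᵒ (I m k) →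
      Gap m k

double-<⁻¹ : ∀ n k → double n ℕ.< 2 ^ suc k → n ℕ.< 2 ^ k
double-<⁻¹ n k lt = ℕP.*-cancelˡ-< 2 n (2 ^ k) (subst (ℕ._< 2 ^ suc k) (sym (2*≡double n)) lt)

I-01 : ∀ n k → n % 2 ≡ 0 → I (suc (double n)) (suc k) ≡ I n k
I-01 n k z = trans (I-odd n k) (trans (cong (λ t → I n k ℕ.+ half-increment t 1) z)
    (ℕP.+-identityʳ _))

I-11 : ∀ n k → n % 2 ≡ 1 → I (suc (double n)) (suc k) ≡ suc (I n k)
I-11 n k o = trans (I-odd n k) (trans (cong (λ t → I n k ℕ.+ half-increment t 1) o)
    (ℕP.+-comm (I n k) 1))

-- Let i = `I n k`. The left half of the interval of n always has length φ^(-2i-2). The right half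
-- is what remains: φ^(-2i-1) for even n, φ^(-2i-3) for odd n. The index that does not grow after
-- the digits 01 is exactly what fits the first of these.
gap : ∀ m k → m ℕ.< 2 ^ k → Gap m k
gap zero zero _ = gap₀ refl refl refl
gap (suc m) zero (s≤s ())
gap m (suc k) m<2^k with parity m
... | even n = gap₀ (double%2 n)
  (trans (C-odd n k) (cong₂ (λ x y → x ℕ.+ Fᵒ y) (sym (C-even n k)) (sym (I-even n k))))
  (trans (H-odd n k) (cong₂ (λ x y → x ℕ.+ Fᵉ y) (sym (H-even n k)) (sym (I-even n k))))
... | odd n with gap n k (double-<⁻¹ n k (ℕP.<-trans (ℕP.n<1+n _) m<2^k))
...   | gap₀ z c h = gap₁ (suc-double%2 n)
        (trans (C-odd n k) (trans (e₁ (C n k) (Fᵒ i) (Fᵉ i))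
            (cong₂ (λ x y → x ℕ.+ Fᵉ (suc y)) (sym (trans (C-even (suc n) k) c))
            (sym (I-01 n k z)))))
        (trans (H-odd n k) (trans (e₂ (H n k) (Fᵒ i) (Fᵉ i))
            (cong₂ (λ x y → x ℕ.+ Fᵒ y) (sym (trans (H-even (suc n) k) h)) (sym (I-01 n k z)))))
  where
  i = I n k
  e₁ : ∀ c o e → c ℕ.+ (o ℕ.+ e ℕ.+ o) ≡ (c ℕ.+ o) ℕ.+ (o ℕ.+ e)
  e₁ = ℕSolver.solve-∀
  e₂ : ∀ h o e → h ℕ.+ (o ℕ.+ e) ≡ (h ℕ.+ e) ℕ.+ o
  e₂ = ℕSolver.solve-∀
...   | gap₁ o c h = gap₁ (suc-double%2 n)
        (trans (C-odd n k) (trans (cong (ℕ._+ Fᵒ (suc i)) c)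
            (trans (e₁ (C (suc n) k) (Fᵒ i) (Fᵉ i))
            (cong₂ (λ x y → x ℕ.+ Fᵉ (suc y)) (sym (C-even (suc n) k)) (sym (I-11 n k o))))))
        (trans (H-odd n k) (trans (cong (ℕ._+ Fᵉ (suc i)) h)
            (trans (e₂ (H (suc n) k) (Fᵒ i) (Fᵉ i))
            (cong₂ (λ x y → x ℕ.+ Fᵒ y) (sym (H-even (suc n) k)) (sym (I-11 n k o))))))
  where
  i = I n k
  e₁ : ∀ c o e → (c ℕ.+ (o ℕ.+ e)) ℕ.+ (o ℕ.+ e ℕ.+ o) ≡ c ℕ.+ (o ℕ.+ e ℕ.+ o ℕ.+ (o ℕ.+ e))
  e₁ = ℕSolver.solve-∀
  e₂ : ∀ h o e → (h ℕ.+ o) ℕ.+ (o ℕ.+ e) ≡ h ℕ.+ (o ℕ.+ e ℕ.+ o)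
  e₂ = ℕSolver.solve-∀

≺-⊹ : ∀ P V → O ≺ V → P ≺ P ⊹ V
≺-⊹ (c , h) (g , n) [ p ] = [ cast (e₁ c g) (e₂ h n) p ]
  where
  e₁ : ∀ c g → g - + 0 ≡ (c + g) - c
  e₁ = solve-∀
  e₂ : ∀ h n → + 0 - n ≡ h - (h + n)
  e₂ = solve-∀

⊹-≺ : ∀ P V → V ≺ O → P ⊹ V ≺ P
⊹-≺ (c , h) (g , n) [ p ] = [ cast (e₁ c g) (e₂ h n) p ]
  where
  e₁ : ∀ c g → + 0 - g ≡ c - (c + g)
  e₁ = solve-∀
  e₂ : ∀ h n → n - + 0 ≡ (h + n) - h
  e₂ = solve-∀

point-suc : ∀ m k → m ℕ.< 2 ^ k → point m k ≺ point (suc m) k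
point-suc m k m<2^k with gap m k m<2^k
... | gap₀ _ c h = subst (point m k ≺_) (cong₂ (λ c h → + c , + h) (sym c) (sym h))
    (≺-⊹ (point m k) (evenPower (I m k)) (O≺even (I m k)))
... | gap₁ _ c h = subst (_≺ point (suc m) k) (cong₂ (λ c h → + c , + h) (sym c) (sym h))
    (⊹-≺ (point (suc m) k) (oddPower (I m k)) (odd≺O (I m k)))

point-increasing : ∀ {m n} k → m ℕ.< n → n ℕ.≤ 2 ^ k → point m k ≺ point n k
point-increasing {m} {suc n} k (s≤s m≤n) n<2^k with ℕP.m≤n⇒m<n∨m≡n m≤n
... | inj₁ m<n  = ≺-trans (point-increasing k m<n (ℕP.<⇒≤ n<2^k)) (point-suc n k n<2^k)
... | inj₂ refl = point-suc m k n<2^k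

point-rescale : ∀ m k t → point (m ℕ.* 2 ^ t) (t ℕ.+ k) ≡ point m k
point-rescale m k zero = cong (λ x → point x k) (ℕP.*-identityʳ m)
point-rescale m k (suc t) = trans (cong (λ x → point x (suc t ℕ.+ k))
    (trans (e m (2 ^ t)) (2*≡double (m ℕ.* 2 ^ t))))
  (trans (point-even (m ℕ.* 2 ^ t) (t ℕ.+ k)) (point-rescale m k t))
  where
  e : ∀ m p → m ℕ.* (2 ℕ.* p) ≡ 2 ℕ.* (m ℕ.* p)
  e = ℕSolver.solve-∀

point-mono-< : ∀ m k m′ k′ → m′ ℕ.≤ 2 ^ k′ → m ℕ.* 2 ^ k′ ℕ.< m′ ℕ.* 2 ^ k → point m k ≺ point m′ k′
point-mono-< m k m′ k′ m′≤ lt = subst₂ _≺_ (point-rescale m k k′)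
    (trans (cong (point (m′ ℕ.* 2 ^ k)) (ℕP.+-comm k′ k)) (point-rescale m′ k′ k))
  (point-increasing (k′ ℕ.+ k) lt (ℕP.≤-trans (ℕP.*-monoˡ-≤ (2 ^ k) m′≤)
      (ℕP.≤-reflexive (sym (ℕP.^-distribˡ-+-* 2 k′ k)))))

point-mono-≡ : ∀ m k m′ k′ → m ℕ.* 2 ^ k′ ≡ m′ ℕ.* 2 ^ k → point m k ≡ point m′ k′
point-mono-≡ m k m′ k′ eq = trans (sym (point-rescale m k k′))
  (trans (cong₂ point eq (ℕP.+-comm k′ k)) (point-rescale m′ k′ k))

point-cancel-≼ : ∀ m k m′ k′ → m ℕ.≤ 2 ^ k → point m k ≼ point m′ k′ → m ℕ.* 2 ^ k′ ℕ.≤ m′ ℕ.* 2 ^ k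
point-cancel-≼ m k m′ k′ m≤ p = ℕP.≮⇒≥ λ lt → ≼⇒⊁ p (point-mono-< m′ k′ m k m≤ lt)

point-cancel-≺ : ∀ m k m′ k′ → m ℕ.≤ 2 ^ k → point m k ≺ point m′ k′ → m ℕ.* 2 ^ k′ ℕ.< m′ ℕ.* 2 ^ k
point-cancel-≺ m k m′ k′ m≤ p with ℕP.m≤n⇒m<n∨m≡n (point-cancel-≼ m k m′ k′ m≤ (inj₁ p))
... | inj₁ lt = lt
... | inj₂ eq = ⊥-elim (≺-irrefl (subst (_≺ point m′ k′) (point-mono-≡ m k m′ k′ eq) p))

H-left< : ∀ n k → H n k ℕ.< H (suc (double n)) (suc k)
H-left< n k = subst (H n k ℕ.<_) (sym (H-odd n k))
    (ℕP.m<m+n _ (ℕP.≤-trans (Fᵒ-positive i) (ℕP.m≤m+n _ _)))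
  where i = I n k

-- The midpoint lies an odd power of φ⁻¹ below the right end, and `oddPower` has a positive heap
-- coordinate.
H-right< : ∀ n k → n ℕ.< 2 ^ k → H (suc n) k ℕ.< H (suc (double n)) (suc k)
H-right< n k n<2^k with gap (suc (double n)) (suc k)
    (subst (ℕ._≤ 2 ^ suc k) (2*≡double (suc n)) (ℕP.*-monoʳ-≤ 2 n<2^k))
... | gap₀ z _ _ with () ← trans (sym z) (suc-double%2 n)
... | gap₁ _ _ h = subst₂ ℕ._<_ (H-even (suc n) k) (sym h)
    (ℕP.m<m+n (H (suc (suc (double n))) (suc k)) (Fᵒ-positive (I (suc (double n)) (suc k))))

-- Surjectivity of ξ: descent through the bisection.

-- The coordinates of X - Yφ in terms of those of φ²(X - Yφ) = (u + 1) - vφ.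
split : ∀ X Y → Y ℕ.< X → X ℕ.≤ 2 ℕ.* Y → ∃[ u ] ∃[ v ]
    (X ≡ suc (u ℕ.+ suc u ℕ.+ v) × Y ≡ suc (u ℕ.+ v))
split X Y Y<X X≤2Y with u , refl ← ℕP.m≤n⇒∃[o]m+o≡n Y<X
  with v , eq ← ℕP.m≤n⇒∃[o]m+o≡n (ℕP.+-cancelˡ-≤ Y (suc u) Y
      (subst₂ ℕ._≤_ (sym (ℕP.+-suc Y u)) (cong (Y ℕ.+_) (ℕP.+-identityʳ Y)) X≤2Y)) =
  u , v , trans (cong (λ y → suc (y ℕ.+ u)) (sym eq)) (e u v) , sym eq
  where
  e : ∀ u v → suc (suc (u ℕ.+ v) ℕ.+ u) ≡ suc (u ℕ.+ suc u ℕ.+ v)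
  e = ℕSolver.solve-∀

module _ (u v : ℕ) where
  private
    X = suc (u ℕ.+ suc u ℕ.+ v)
    Y = suc (u ℕ.+ v)

  ·φ²₁ : Pos (+ X) (- + Y) → Pos (+ suc u) (- + v)
  ·φ²₁ p = cast (e₁ (+ u) (+ v)) (e₂ (+ u) (+ v)) (·φ (·φ p))
    where
    e₁ : ∀ u v → (+ 1 + (u + (+ 1 + u) + v)) + - (+ 1 + (u + v)) ≡ + 1 + u
    e₁ = solve-∀
    e₂ : ∀ u v → - (+ 1 + (u + v)) + ((+ 1 + (u + (+ 1 + u) + v)) + - (+ 1 + (u + v))) ≡ - v
    e₂ = solve-∀

  ·φ²₂ : Pos (- + (u ℕ.+ suc u ℕ.+ v)) (+ Y) → Pos (- + u) (+ suc v)
  ·φ²₂ p = cast (e₁ (+ u) (+ v)) (e₂ (+ u) (+ v)) (·φ (·φ p))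
    where
    e₁ : ∀ u v → - (u + (+ 1 + u) + v) + (+ 1 + (u + v)) ≡ - u
    e₁ = solve-∀
    e₂ : ∀ u v → (+ 1 + (u + v)) + (- (u + (+ 1 + u) + v) + (+ 1 + (u + v))) ≡ + 1 + v
    e₂ = solve-∀

  ·φ²₃ : Pos (- + suc X) (+ suc Y) → Pos (- + suc u) (+ suc v)
  ·φ²₃ p = cast (e₁ (+ u) (+ v)) (e₂ (+ u) (+ v)) (·φ (·φ p))
    where
    e₁ : ∀ u v → - (+ 1 + (+ 1 + (u + (+ 1 + u) + v))) + (+ 1 + (+ 1 + (u + v))) ≡ - (+ 1 + u)
    e₁ = solve-∀
    e₂ : ∀ u v → (+ 1 + (+ 1 + (u + v))) + (- (+ 1 + (+ 1 + (u + (+ 1 + u) + v)))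
        + (+ 1 + (+ 1 + (u + v)))) ≡ + 1 + v
    e₂ = solve-∀

Reached : ℕ → ℕ → Set
Reached c h = ∃[ m ] ∃[ k ] (m ℕ.≤ 2 ^ k × C m k ≡ c × H m k ≡ h)

-- An integer point strictly between the points of m/2ᵏ and (m + 1)/2ᵏ has
-- nonnegative coordinates with respect to the vectors that lead from these two
-- ends to the point of the midpoint; the coordinates shrink when an interval
-- is bisected.
descend₀ : ∀ s m k → m ℕ.< 2 ^ k → m % 2 ≡ 0 → ∀ a b → suc a ℕ.+ b ℕ.≤ s →
  Pos (+ suc a) (- + b) → Pos (- + a) (+ suc b) →
  Reached (C m k ℕ.+ (suc a ℕ.* Fᵒ (suc (I m k)) ℕ.+ b ℕ.* Fᵉ (suc (I m k))))
          (H m k ℕ.+ (suc a ℕ.* Fᵉ (suc (I m k)) ℕ.+ b ℕ.* Fᵒ (I m k)))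
descend₁ : ∀ s m k → m ℕ.< 2 ^ k → m % 2 ≡ 1 → ∀ p n → suc p ℕ.+ n ℕ.≤ s →
  Pos (+ suc p) (- + n) → Pos (- + suc p) (+ suc n) →
  Reached (C (suc m) k ℕ.+ (suc p ℕ.* Fᵒ (suc (I m k)) ℕ.+ suc n ℕ.* Fᵉ (suc (I m k))))
          (H (suc m) k ℕ.+ (suc p ℕ.* Fᵉ (suc (I m k)) ℕ.+ suc n ℕ.* Fᵒ (I m k)))

reach : ∀ {c h} m k → m ℕ.≤ 2 ^ k → C m k ≡ c → H m k ≡ h → Reached c h
reach m k m≤ p q = m , k , m≤ , p , q

left<right< : ∀ m k → m ℕ.< 2 ^ k → suc (double m) ℕ.< 2 ^ suc k
left<right< m k lt = subst (ℕ._≤ 2 ^ suc k) (2*≡double (suc m)) (ℕP.*-monoʳ-≤ 2 lt)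

descend₀ (suc s) m k m<2^k z a b (s≤s bound) low high with sign-by-norm a b
... | inj₂ (inj₁ (refl , refl)) =
  reach (suc (double m)) (suc k) (ℕP.<⇒≤ (left<right< m k m<2^k))
    (trans (C-odd m k) (cong (C m k ℕ.+_) (sym (trans (ℕP.+-identityʳ _) (ℕP.+-identityʳ _)))))
    (trans (H-odd m k) (cong (H m k ℕ.+_) (sym (trans (ℕP.+-identityʳ _) (ℕP.+-identityʳ _)))))
-- Left half: the target lies (a + 1) - bφ units of φ^(-2i-2) above the left end. The left end stays
-- and the unit shrinks by φ², so the number is multiplied by φ².
... | inj₂ (inj₂ (a<bφ , _))
  with u , v , refl , refl ← split (suc a) b (bφ<a⇒b<a (suc a) b low) (a<bφ⇒a<2b a b a<bφ) =
  subst₂ Reached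
    (cong₂ ℕ._+_ (C-even m k) (trans (cong (λ i → suc u ℕ.* Fᵒ (suc i) ℕ.+ v ℕ.* Fᵉ (suc i))
        (I-even m k)) (e₁ u v (Fᵒ i) (Fᵉ i))))
    (cong₂ ℕ._+_ (H-even m k) (trans (cong (λ i → suc u ℕ.* Fᵉ (suc i) ℕ.+ v ℕ.* Fᵒ i)
        (I-even m k)) (e₂ u v (Fᵒ i) (Fᵉ i))))
    (descend₀ s (double m) (suc k) (ℕP.<-trans (ℕP.n<1+n _) (left<right< m k m<2^k))
        (double%2 m) u v
      (ℕP.≤-trans (ℕP.m≤n+m (suc (u ℕ.+ v)) (u ℕ.+ suc u ℕ.+ v)) bound)
      (·φ²₁ u v low) (·φ²₂ u v a<bφ))
  where
  i = I m k
  e₁ : ∀ u v o e → suc u ℕ.* ((o ℕ.+ e ℕ.+ o ℕ.+ (o ℕ.+ e)) ℕ.+ (o ℕ.+ e ℕ.+ o)) ℕ.+ v ℕ.*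
      (o ℕ.+ e ℕ.+ o ℕ.+ (o ℕ.+ e))
     ≡ suc (u ℕ.+ suc u ℕ.+ v) ℕ.* (o ℕ.+ e ℕ.+ o) ℕ.+ suc (u ℕ.+ v) ℕ.* (o ℕ.+ e)
  e₁ = ℕSolver.solve-∀
  e₂ : ∀ u v o e → suc u ℕ.* (o ℕ.+ e ℕ.+ o ℕ.+ (o ℕ.+ e)) ℕ.+ v ℕ.* (o ℕ.+ e ℕ.+ o)
     ≡ suc (u ℕ.+ suc u ℕ.+ v) ℕ.* (o ℕ.+ e) ℕ.+ suc (u ℕ.+ v) ℕ.* o
  e₂ = ℕSolver.solve-∀
-- Right half: measured from the right end, the target loses φ² = 1 + φ units, which changes either
-- coordinate by 1. The unit is kept, because the last digits are now 01.
descend₀ (suc s) m k m<2^k z (suc a) b (s≤s bound) low high | inj₁ (bφ<a , _)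
  with gap m k m<2^k
... | gap₁ o _ _ with () ← trans (sym z) o
... | gap₀ _ c h =
  subst₂ Reached
    (trans (cong₂ (λ x i → x ℕ.+ (suc a ℕ.* Fᵒ (suc i) ℕ.+ suc b ℕ.* Fᵉ (suc i)))
        (trans (C-even (suc m) k) c) (I-01 m k z)) (e₁ a b (C m k) (Fᵒ i) (Fᵉ i)))
    (trans (cong₂ (λ x i → x ℕ.+ (suc a ℕ.* Fᵉ (suc i) ℕ.+ suc b ℕ.* Fᵒ i))
        (trans (H-even (suc m) k) h) (I-01 m k z)) (e₂ a b (H m k) (Fᵒ i) (Fᵉ i)))
    (descend₁ s (suc (double m)) (suc k) (left<right< m k m<2^k) (suc-double%2 m) a b bound bφ<a
        high)
  where
  i = I m k
  e₁ : ∀ a b c o e → (c ℕ.+ o) ℕ.+ (suc a ℕ.* (o ℕ.+ e ℕ.+ o) ℕ.+ suc b ℕ.* (o ℕ.+ e))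
     ≡ c ℕ.+ (suc (suc a) ℕ.* (o ℕ.+ e ℕ.+ o) ℕ.+ b ℕ.* (o ℕ.+ e))
  e₁ = ℕSolver.solve-∀
  e₂ : ∀ a b h o e → (h ℕ.+ e) ℕ.+ (suc a ℕ.* (o ℕ.+ e) ℕ.+ suc b ℕ.* o)
     ≡ h ℕ.+ (suc (suc a) ℕ.* (o ℕ.+ e) ℕ.+ b ℕ.* o)
  e₂ = ℕSolver.solve-∀
descend₀ (suc s) m k m<2^k z zero b (s≤s bound) low high | inj₁ (bφ<a , _) = ⊥-elim
    (¬Pos-nonpos 0 b bφ<a)

descend₁ (suc s) m k m<2^k o p n (s≤s bound) low high with gap m k m<2^k
... | gap₀ z _ _ with () ← trans (sym z) o
... | gap₁ _ c h with sign-by-norm p n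
...   | inj₂ (inj₁ (refl , refl)) =
  reach (suc (double m)) (suc k) (ℕP.<⇒≤ (left<right< m k m<2^k))
    (trans (C-odd m k) (trans (cong (ℕ._+ Fᵒ (suc i)) c) (e₁ (C (suc m) k) (Fᵒ i) (Fᵉ i))))
    (trans (H-odd m k) (trans (cong (ℕ._+ Fᵉ (suc i)) h) (e₂ (H (suc m) k) (Fᵒ i) (Fᵉ i))))
  where
  i = I m k
  e₁ : ∀ c o e → (c ℕ.+ (o ℕ.+ e)) ℕ.+ (o ℕ.+ e ℕ.+ o) ≡ c ℕ.+
      (1 ℕ.* (o ℕ.+ e ℕ.+ o) ℕ.+ 1 ℕ.* (o ℕ.+ e))
  e₁ = ℕSolver.solve-∀
  e₂ : ∀ h o e → (h ℕ.+ o) ℕ.+ (o ℕ.+ e) ≡ h ℕ.+ (1 ℕ.* (o ℕ.+ e) ℕ.+ 1 ℕ.* o)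
  e₂ = ℕSolver.solve-∀
...   | inj₂ (inj₂ (p<nφ , _))
  with u , v , refl , refl ← split (suc p) n (bφ<a⇒b<a (suc p) n low) (a<bφ⇒a<2b p n p<nφ) =
  subst₂ Reached
    (trans (cong₂ (λ x i → x ℕ.+ (suc u ℕ.* Fᵒ (suc i) ℕ.+ v ℕ.* Fᵉ (suc i))) (trans (C-even m k) c)
        (I-even m k)) (e₁ u v (C (suc m) k) (Fᵒ i) (Fᵉ i)))
    (trans (cong₂ (λ x i → x ℕ.+ (suc u ℕ.* Fᵉ (suc i) ℕ.+ v ℕ.* Fᵒ i)) (trans (H-even m k) h)
        (I-even m k)) (e₂ u v (H (suc m) k) (Fᵒ i) (Fᵉ i)))
    (descend₀ s (double m) (suc k) (ℕP.<-trans (ℕP.n<1+n _) (left<right< m k m<2^k))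
        (double%2 m) u v
      (ℕP.≤-trans (ℕP.m≤n+m (suc (u ℕ.+ v)) (u ℕ.+ suc u ℕ.+ v)) bound)
      (·φ²₁ u v low) (·φ²₂ u v p<nφ))
  where
  i = I m k
  e₁ : ∀ u v c o e → (c ℕ.+ (o ℕ.+ e)) ℕ.+ (suc u ℕ.* ((o ℕ.+ e ℕ.+ o ℕ.+ (o ℕ.+ e)) ℕ.+
      (o ℕ.+ e ℕ.+ o)) ℕ.+ v ℕ.* (o ℕ.+ e ℕ.+ o ℕ.+ (o ℕ.+ e)))
     ≡ c ℕ.+ (suc (u ℕ.+ suc u ℕ.+ v) ℕ.* (o ℕ.+ e ℕ.+ o) ℕ.+ suc (suc (u ℕ.+ v)) ℕ.* (o ℕ.+ e))
  e₁ = ℕSolver.solve-∀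
  e₂ : ∀ u v h o e → (h ℕ.+ o) ℕ.+ (suc u ℕ.* (o ℕ.+ e ℕ.+ o ℕ.+ (o ℕ.+ e)) ℕ.+ v ℕ.*
      (o ℕ.+ e ℕ.+ o))
     ≡ h ℕ.+ (suc (u ℕ.+ suc u ℕ.+ v) ℕ.* (o ℕ.+ e) ℕ.+ suc (suc (u ℕ.+ v)) ℕ.* o)
  e₂ = ℕSolver.solve-∀
-- Right half: the right end stays and the unit shrinks by φ². As φ²(1 - φ) = -φ, the coordinates
-- found for p - nφ serve for (p + 1) - (n + 1)φ once `v` is raised by 1.
...   | inj₁ (nφ<p , _)
  with u , v , refl , refl ← split p n (bφ<a⇒b<a p n nφ<p)
        (ℕP.≤-pred (ℕP.≤-pred (subst (suc (suc p) ℕ.≤_) (ℕP.*-suc 2 n)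
            (a<bφ⇒a<2b (suc p) (suc n) high)))) =
  subst₂ Reached
    (trans (cong₂ (λ x i → x ℕ.+ (suc u ℕ.* Fᵒ (suc i) ℕ.+ suc v ℕ.* Fᵉ (suc i))) (C-even (suc m) k)
        (I-11 m k o)) (cong (C (suc m) k ℕ.+_) (e₁ u v (Fᵒ i) (Fᵉ i))))
    (trans (cong₂ (λ x i → x ℕ.+ (suc u ℕ.* Fᵉ (suc i) ℕ.+ suc v ℕ.* Fᵒ i)) (H-even (suc m) k)
        (I-11 m k o)) (cong (H (suc m) k ℕ.+_) (e₂ u v (Fᵒ i) (Fᵉ i))))
    (descend₁ s (suc (double m)) (suc k) (left<right< m k m<2^k) (suc-double%2 m) u v
      (ℕP.≤-trans (ℕP.m≤n+m (suc (u ℕ.+ v)) (suc (u ℕ.+ suc u ℕ.+ v))) bound)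
      (·φ²₁ u v nφ<p) (·φ²₃ u v high))
  where
  i = I m k
  e₁ : ∀ u v o e → suc u ℕ.* ((o ℕ.+ e ℕ.+ o ℕ.+ (o ℕ.+ e)) ℕ.+ (o ℕ.+ e ℕ.+ o)) ℕ.+ suc v ℕ.*
      (o ℕ.+ e ℕ.+ o ℕ.+ (o ℕ.+ e))
     ≡ suc (suc (u ℕ.+ suc u ℕ.+ v)) ℕ.* (o ℕ.+ e ℕ.+ o) ℕ.+ suc (suc (u ℕ.+ v)) ℕ.* (o ℕ.+ e)
  e₁ = ℕSolver.solve-∀
  e₂ : ∀ u v o e → suc u ℕ.* (o ℕ.+ e ℕ.+ o ℕ.+ (o ℕ.+ e)) ℕ.+ suc v ℕ.* (o ℕ.+ e ℕ.+ o)
     ≡ suc (suc (u ℕ.+ suc u ℕ.+ v)) ℕ.* (o ℕ.+ e) ℕ.+ suc (suc (u ℕ.+ v)) ℕ.* o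
  e₂ = ℕSolver.solve-∀

surjective : ∀ c h → O ≼ (c , + h) → (c , + h) ≼ φ⁻² → ∃[ m ] ∃[ k ]
    (m ℕ.≤ 2 ^ k × point m k ≡ (c , + h))
surjective c h (inj₂ refl) _ = 0 , 0 , z≤n , refl
surjective c h (inj₁ _) (inj₂ refl) = 1 , 0 , s≤s z≤n , refl
surjective c h (inj₁ [ p ]) (inj₁ [ q ]) =
  -- The coordinates of φ⁴(c - hφ): the descent starts at [0 , φ⁻²], whose unit is φ⁻⁴, the point of
  -- 1/2. That h is a natural number excludes pairs of the wrong sign.
  conclude (+ 2 * c - + 3 * + h) (+ 5 * + h - + 3 * c)
    (cast (e₁ c (+ h)) (e₂ c (+ h)) (·φ (·φ (·φ (·φ p)))))
    (cast (e₃ c (+ h)) (e₄ c (+ h)) (·φ (·φ (·φ (·φ q)))))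
    (e₅ c (+ h)) (e₆ c (+ h))
  where
  e₁ : ∀ c h → ((c - + 0) + (+ 0 - h)) + ((+ 0 - h) + ((c - + 0) + (+ 0 - h))) ≡ + 2 * c - + 3 * h
  e₁ = solve-∀
  e₂ : ∀ c h → ((+ 0 - h) + ((c - + 0) + (+ 0 - h)))
      + (((c - + 0) + (+ 0 - h)) + ((+ 0 - h) + ((c - + 0) + (+ 0 - h))))
     ≡ - (+ 5 * h - + 3 * c)
  e₂ = solve-∀
  e₃ : ∀ c h → ((+ 2 - c) + (h - + 1)) + ((h - + 1) + ((+ 2 - c) + (h - + 1))) ≡ + 1
      - (+ 2 * c - + 3 * h)
  e₃ = solve-∀
  e₄ : ∀ c h → ((h - + 1) + ((+ 2 - c) + (h - + 1)))
      + (((+ 2 - c) + (h - + 1)) + ((h - + 1) + ((+ 2 - c) + (h - + 1))))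
     ≡ + 1 + (+ 5 * h - + 3 * c)
  e₄ = solve-∀
  e₅ : ∀ c h → h ≡ + 3 * (+ 2 * c - + 3 * h) + + 2 * (+ 5 * h - + 3 * c)
  e₅ = solve-∀
  e₆ : ∀ c h → c ≡ + 5 * (+ 2 * c - + 3 * h) + + 3 * (+ 5 * h - + 3 * c)
  e₆ = solve-∀
  e₇ : ∀ a → + 1 - (+ 1 + a) ≡ - a
  e₇ = solve-∀
  e₈ : ∀ x a y b → x ℕ.* suc a ℕ.+ y ℕ.* b ≡ suc a ℕ.* x ℕ.+ b ℕ.* y
  e₈ = ℕSolver.solve-∀
  positive : ∀ x a y b → + x * + a + + y * + b ≡ + (x ℕ.* a ℕ.+ y ℕ.* b)
  positive x a y b = sym (cong₂ _+_ (ℤP.pos-* x a) (ℤP.pos-* y b))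
  conclude : ∀ a b → Pos a (- b) → Pos (+ 1 - a) (+ 1 + b) → + h ≡ + 3 * a + + 2 * b → c ≡ + 5 * a
      + + 3 * b →
    ∃[ m ] ∃[ k ] (m ℕ.≤ 2 ^ k × point m k ≡ (c , + h))
  conclude (+ suc a) (+ b) p q eqh eqc
    with m , k , m≤ , eqC , eqH ← descend₀ _ 0 0 (s≤s z≤n) refl a b ℕP.≤-refl p
        (cast (e₇ (+ a)) refl q) =
    m , k , m≤ , cong₂ _,_
      (trans (cong +_ eqC) (sym (trans eqc (trans (positive 5 (suc a) 3 b)
          (cong +_ (e₈ 5 a 3 b))))))
      (trans (cong +_ eqH) (sym (trans eqh (trans (positive 3 (suc a) 2 b)
          (cong +_ (e₈ 3 a 2 b))))))
  conclude (+ zero)  (+ b)     p _ _ _ = ⊥-elim (¬Pos-nonpos 0 b p)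
  conclude -[1+ a ]  (+ b)     p _ _ _ = ⊥-elim (¬Pos-nonpos (suc a) b p)
  conclude (+ suc a) -[1+ b ]  _ q _ _ = ⊥-elim (¬Pos-nonpos a b (cast (e₇ (+ a)) (e₇ (+ b)) q))
  conclude (+ zero)  -[1+ b ]  _ _ () _
  conclude -[1+ a ]  -[1+ b ]  _ _ () _

-- The digit sum ξ agrees with the recursion `H`.

digitℕ : ℕ → ℕ → ℕ → ℕ
digitℕ m k i = ((m ℕ.* 2 ^ i / 2 ^ k) {{ℕP.m^n≢0 2 k}}) % 2

digit≡ : ∀ m k i → digit ((+ m) /2^ k) i ≡ digitℕ m k i
digit≡ m k i = cong (λ x → ((x /ℕ (2 ^ k)) {{ℕP.m^n≢0 2 k}}) %ℕ 2) (sym (ℤP.pos-* m (2 ^ i)))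

last-digit : ∀ m k → digitℕ m k k ≡ m % 2
last-digit m k = cong (_% 2) (DM.m*n/n≡m m (2 ^ k) {{ℕP.m^n≢0 2 k}})

digit-shift : ∀ m i t → (m ℕ.* 2 ^ i / 2 ^ (t ℕ.+ i)) {{ℕP.m^n≢0 2 (t ℕ.+ i)}} ≡ (m / 2 ^ t)
    {{ℕP.m^n≢0 2 t}}
digit-shift m i t = trans
  (DM./-congʳ {{ℕP.m^n≢0 2 (t ℕ.+ i)}} {{ℕP.m*n≢0 (2 ^ t) (2 ^ i) {{ℕP.m^n≢0 2 t}}
      {{ℕP.m^n≢0 2 i}}}} (ℕP.^-distribˡ-+-* 2 t i))
  (DM.m*n/o*n≡m/o m (2 ^ i) (2 ^ t) {{ℕP.m^n≢0 2 t}}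
      {{ℕP.m*n≢0 (2 ^ t) (2 ^ i) {{ℕP.m^n≢0 2 t}} {{ℕP.m^n≢0 2 i}}}})

digit-prefix : ∀ m k i → i ℕ.≤ k → digitℕ m (suc k) i ≡ digitℕ (m / 2) k i
digit-prefix m k i i≤k with t , eq ← ℕP.m≤n⇒∃[o]m+o≡n i≤k with refl ← trans (ℕP.+-comm t i) eq =
  cong (_% 2) (trans (digit-shift m i (suc t)) (trans
    (sym (DM.m/n/o≡m/[n*o] m 2 (2 ^ t) {{_}} {{ℕP.m^n≢0 2 t}} {{ℕP.m^n≢0 2 (suc t)}}))
        (sym (digit-shift (m / 2) i t))))

index-cong : ∀ {d d′} n → (∀ i → i ℕ.< n → d i ≡ d′ i) → index d n ≡ index d′ n
index-cong 0 _ = refl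
index-cong 1 _ = refl
index-cong (suc (suc n)) eq = cong₂ ℕ._+_
  (index-cong (suc n) λ i i<n → eq i (ℕP.m≤n⇒m≤1+n i<n))
  (cong₂ increment (eq n (ℕP.m≤n⇒m≤1+n (ℕP.n<1+n n))) (eq (suc n) ℕP.≤-refl))

sum≤-cong : ∀ {f g} n → (∀ i → i ℕ.≤ n → f i ≡ g i) → sum≤ n f ≡ sum≤ n g
sum≤-cong zero eq = eq 0 z≤n
sum≤-cong (suc n) eq = cong₂ ℕ._+_ (sum≤-cong n λ i i≤n → eq i (ℕP.m≤n⇒m≤1+n i≤n))
    (eq (suc n) ℕP.≤-refl)

increment≡ : ∀ a b → increment a b ≡ double (half-increment a b)
increment≡ 0 0 = refl
increment≡ 0 1 = refl
increment≡ 0 (suc (suc _)) = refl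
increment≡ (suc _) _ = refl

double-+ : ∀ m n → double m ℕ.+ double n ≡ double (m ℕ.+ n)
double-+ zero n = refl
double-+ (suc m) n = cong (λ t → suc (suc t)) (double-+ m n)

next-index : ∀ m k → index (digitℕ m k) (suc k) ≡ double (suc (I m k))
next-index m zero = refl
next-index m (suc k) = trans (cong₂ ℕ._+_
    (trans (index-cong (suc k) λ i i<k → digit-prefix m k i (ℕP.≤-pred i<k)) (next-index (m / 2) k))
    (trans (cong₂ increment (trans (digit-prefix m k k ℕP.≤-refl) (last-digit (m / 2) k))
        (last-digit m (suc k)))
           (increment≡ ((m / 2) % 2) (m % 2))))
  (double-+ (suc (I (m / 2) k)) _)

ξℕ : ℕ → ℕ → ℕ
ξℕ m k = sum≤ k λ i → digitℕ m k i ℕ.* F (index (digitℕ m k) i)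

ξℕ≡H : ∀ m k → ξℕ m k ≡ H m k
ξℕ≡H m zero = trans (ℕP.*-identityʳ _) (last-digit m 0)
ξℕ≡H m (suc k) = cong₂ ℕ._+_
  (trans (sum≤-cong k λ i i≤k → cong₂ ℕ._*_ (digit-prefix m k i i≤k)
      (cong F (index-cong i λ j j<i → digit-prefix m k j (ℕP.≤-trans (ℕP.<⇒≤ j<i) i≤k))))
    (ξℕ≡H (m / 2) k))
  (cong₂ ℕ._*_ (last-digit m (suc k)) (cong F (trans
    (index-cong (suc k) λ i i<k → digit-prefix m k i (ℕP.≤-pred i<k)) (next-index (m / 2) k))))

ξ≡H : ∀ m k → ξ ((+ m) /2^ k) ≡ H m k
ξ≡H m k = trans (sum≤-cong k λ i _ → cong₂ ℕ._*_ (digit≡ m k i)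
    (cong F (index-cong i λ j _ → digit≡ m k j))) (ξℕ≡H m k)

-- The values of the heaps in 𝒬

point-≤φ⁻² : ∀ m k → m ℕ.≤ 2 ^ k → point m k ≼ φ⁻²
point-≤φ⁻² m k m≤ with ℕP.m≤n⇒m<n∨m≡n m≤
... | inj₁ lt = inj₁ (point-mono-< m k 1 0 ℕP.≤-refl (subst₂ ℕ._<_ (sym (ℕP.*-identityʳ m))
    (sym (ℕP.*-identityˡ _)) lt))
... | inj₂ eq = inj₂ (point-mono-≡ m k 1 0 (trans (ℕP.*-identityʳ m)
    (trans eq (sym (ℕP.*-identityˡ _)))))

O≼point : ∀ m k → m ℕ.≤ 2 ^ k → O ≼ point m k
O≼point zero k _ = inj₂ (point-mono-≡ 0 0 0 k refl)
O≼point (suc m) k m≤ = inj₁ (point-mono-< 0 0 (suc m) k m≤ (s≤s z≤n))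

record Options (m k : ℕ) : Set₁ where
  field
    {L R}  : Set
    {Gᴸ}   : L → Game
    {Gᴿ}   : R → Game
    isGame : fracGame m k ≡ ⟨ Gᴸ ∣ Gᴿ ⟩
    left   : ∀ i → ∃[ a ] ∃[ b ] (Gᴸ i ≡ fracGame a b × a ℕ.≤ 2 ^ b × point a b ≺ point m k × H a b
        ℕ.< H m k)
    right  : ∀ j → ∃[ a ] ∃[ b ] (Gᴿ j ≡ fracGame a b × a ℕ.≤ 2 ^ b × point m k ≺ point a b × H a b
        ℕ.< H m k)

options? : ∀ m k → m ℕ.≤ 2 ^ k → Options m k ⊎ Halvable m k
options? zero zero _ = inj₁ record { isGame = refl ; left = λ () ; right = λ () }
options? (suc zero) zero _ = inj₁ record
  { isGame = refl ; left = λ _ → 0 , 0 , refl , z≤n , ≺-trans O≺φ⁻⁴ (≺-trans φ⁻⁴≺φ⁻³ φ⁻³≺φ⁻²) , s≤s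
      z≤n ; right = λ () }
options? (suc (suc m)) zero (s≤s ())
options? m (suc k) m≤ with parity m
... | even n = inj₂ (n , k , refl , refl)
... | odd n = inj₁ record
  { isGame = fracGame-odd n k
  ; left   = λ _ → n , k , refl , ℕP.<⇒≤ n<2^k
                 , subst (_≺ point (suc (double n)) (suc k)) (point-even n k)
                     (point-suc (double n) (suc k) m≤) , H-left< n k
  ; right  = λ _ → suc n , k , refl , n<2^k
                 , subst (point (suc (double n)) (suc k) ≺_) (point-even (suc n) k)
                     (point-suc (suc (double n)) (suc k) (left<right< n k n<2^k)) , H-right< n k
                     n<2^k }
  where
  n<2^k : n ℕ.< 2 ^ k
  n<2^k = double-<⁻¹ n k m≤

-- The comparison is assumed for every accessibility proof, because the game of a heap is built from
-- such a proof and a move produces its own.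
Right-refutes : ∀ {X k k′} → ∃[ i ] (1 ℕ.≤ i × B i ℕ.+ k′ ≡ k) → (∀ ac → heapAcc k′ ac ≤ᴳ X) →
  ∀ ac → ¬ (X ≤ᴳ heapAcc k ac)
Right-refutes {⟨ _ ∣ _ ⟩} {k} {k′} (i , 1≤i , refl) G≤X (acc rs) (_ , q) =
  q (i , 1≤i , ℕP.m≤m+n (B i) k′) (subst (λ t → ∀ ac → heapAcc t ac ≤ᴳ _)
      (sym (ℕP.m+n∸m≡n (B i) k′)) G≤X _)

Left-refutes : ∀ {X k k′} → ∃[ i ] (1 ℕ.≤ i × A i ℕ.+ k′ ≡ k) → (∀ ac → X ≤ᴳ heapAcc k′ ac) →
  ∀ ac → ¬ (heapAcc k ac ≤ᴳ X)
Left-refutes {⟨ _ ∣ _ ⟩} {k} {k′} (i , 1≤i , refl) X≤G (acc rs) (p , _) =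
  p (i , 1≤i , ℕP.m≤m+n (A i) k′) (subst (λ t → ∀ ac → _ ≤ᴳ heapAcc t ac)
      (sym (ℕP.m+n∸m≡n (A i) k′)) X≤G _)

HasValue : ℕ → Set
HasValue h = ∀ c m k → Good c h → m ℕ.≤ 2 ^ k → point m k ≡ (c , + h) → ∀ ac → heapAcc h ac ≈ᴳ
    fracGame m k

Good-0 : Good (+ 0) 0
Good-0 = exceptional 0 refl

Good-1 : Good (+ 2) 1
Good-1 = window φ⁻³≺φ⁻² (inj₂ refl)

-- The points of the empty heap are integers, and none lies in (φ⁻² , 1). The upper bound is
-- `φ⁻² ⊹ φ⁻¹`; Left needs the counter to move to the heap 1.
φ⁻²≺∧<1⇒1≤ : ∀ c k → φ⁻² ≺ (c , + k) → (c , + k) ≺ (+ 1 , + 0) → 1 ℕ.≤ k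
φ⁻²≺∧<1⇒1≤ c (suc k) _ _ = s≤s z≤n
φ⁻²≺∧<1⇒1≤ c zero p [ q ] with [ r ] ← ≺-trans (≺-trans O≺φ⁻⁴ (≺-trans φ⁻⁴≺φ⁻³ φ⁻³≺φ⁻²)) p = ⊥-elim
    (absurd c r q)
  where
  e : ∀ a → + 1 - (+ 1 + a) ≡ - a
  e = solve-∀
  absurd : ∀ c → Pos (c - + 0) (+ 0) → ¬ Pos (+ 1 - c) (+ 0)
  absurd (+ zero) r _ = ¬Pos-nonpos 0 0 r
  absurd (+ suc a) _ q = ¬Pos-nonpos a 0 (cast (e (+ a)) refl q)
  absurd -[1+ a ] r _ = ¬Pos-nonpos (suc a) 0 (cast (ℤP.+-identityʳ -[1+ a ]) refl r)

-- Only a few moves matter: a Left option that is not itself a good heap is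
-- answered by a move of Right to a good heap of smaller value, and a Right
-- option that is not good by the move of Left to the heap 1.
module _ (h : ℕ) (rec : ∀ {h′} → h′ ℕ.< h → HasValue h′) (c : ℤ) (good : Good c h)
         (m k : ℕ) (m≤ : m ℕ.≤ 2 ^ k) (eq : point m k ≡ (c , + h)) where
  private
    P : Point
    P = c , + h

  smaller : ∀ {c′ h′} → h′ ℕ.< h → Good c′ h′ → (c′ , + h′) ≺ P →
    ∃[ a ] ∃[ b ] (a ℕ.≤ 2 ^ b × point a b ≡ (c′ , + h′) × a ℕ.* 2 ^ k ℕ.< m ℕ.* 2 ^ b ×
        (∀ ac → heapAcc h′ ac ≈ᴳ fracGame a b))
  smaller {c′} {h′} h′<h g p with a , b , a≤ , eq′ ← surjective c′ h′ (Good⇒O≼ g) (Good⇒≼φ⁻² g) =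
    a , b , a≤ , eq′ , point-cancel-≺ a b m k a≤ (subst₂ _≺_ (sym eq′) (sym eq) p) , rec h′<h c′ a b
        g a≤ eq′

  Left-option : ∀ i → 1 ℕ.≤ i → A i ℕ.≤ h → ∀ ac → ¬ (fracGame m k ≤ᴳ heapAcc (h ℕ.∸ A i) ac)
  Left-option i 1≤i Ai≤h ac X≤G with c′ , P′≺P , P≺P′+φ⁻¹ ← A-move⁻¹ c 1≤i Ai≤h with ≼⊎≻ O
      (c′ , + (h ℕ.∸ A i))
  ... | inj₂ P′≺O = Right-refutes (B-move z≤n P′≺O (Good-near-O {c′ = c′} good k<h P≺P′+φ⁻¹))
      (λ ac → ≤ᴳ-trans _ _ _ (proj₁ (rec (ℕP.≤-<-trans z≤n k<h) (+ 0) 0 0 Good-0 z≤n refl ac))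
          (fractionGame-mono 0 0 m k z≤n))
      ac X≤G
    where k<h = ℕP.∸-monoʳ-< (A-positive 1≤i) Ai≤h
  ... | inj₁ O≼P′
    with c″ , e , g , e≤k , le , E≺P ← Good-below good (ℕP.∸-monoʳ-< (A-positive 1≤i) Ai≤h) O≼P′
        P′≺P
    with a , b , a≤ , eq′ , lt , val ← smaller
        (ℕP.≤-<-trans e≤k (ℕP.∸-monoʳ-< (A-positive 1≤i) Ai≤h)) g E≺P
    with le
  ...   | inj₂ refl = fractionGame-strict a b m k lt (≤ᴳ-trans _ _ _ X≤G (proj₁ (val ac)))
  -- The reply is legal: its point is below that of h, hence below φ⁻², and so within φ⁻² of a point
  -- that is at least 0.
  ...   | inj₁ P′≺E = Right-refutes
          (B-move e≤k P′≺E (≺-≼-trans E≺P (≼-trans (Good⇒≼φ⁻² good) (≼-shift φ⁻² O≼P′))))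
          (λ ac → ≤ᴳ-trans _ _ _ (proj₁ (val ac)) (fractionGame-mono a b m k (ℕP.<⇒≤ lt))) ac X≤G

  Right-option : ∀ i → 1 ℕ.≤ i → B i ℕ.≤ h → ∀ ac → ¬ (heapAcc (h ℕ.∸ B i) ac ≤ᴳ fracGame m k)
  Right-option i 1≤i Bi≤h ac G≤X with c′ , P≺P′ , P′≺P+φ⁻² ← B-move⁻¹ c 1≤i Bi≤h with ≼⊎≻
      (c′ , + (h ℕ.∸ B i)) φ⁻²
  ... | inj₁ P′≼φ⁻² =
    let k<h = ℕP.∸-monoʳ-< (B-positive 1≤i) Bi≤h
        g = Good-above good k<h P≺P′ P′≼φ⁻²
        a , b , a≤ , eq′ = surjective c′ (h ℕ.∸ B i) (Good⇒O≼ g) P′≼φ⁻²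
    in fractionGame-strict m k a b (point-cancel-≺ m k a b m≤ (subst₂ _≺_ (sym eq) (sym eq′) P≺P′))
         (≤ᴳ-trans _ _ _ (proj₂ (rec k<h c′ a b g a≤ eq′ ac)) G≤X)
  ... | inj₂ φ⁻²≺P′ = Left-refutes (A-move 1≤k φ⁻²≺P′ P′≺φ⁻²+φ⁻¹)
      (λ ac → ≤ᴳ-trans _ _ _ (fractionGame-mono m k 1 0 (subst₂ ℕ._≤_ (sym (ℕP.*-identityʳ m))
          (sym (ℕP.*-identityˡ _)) m≤))
                (proj₂ (rec (ℕP.≤-<-trans 1≤k k<h) (+ 2) 1 0 Good-1 (s≤s z≤n) refl ac)))
      ac G≤X
    where
    k<h = ℕP.∸-monoʳ-< (B-positive 1≤i) Bi≤h
    P′≺φ⁻²+φ⁻¹ : (c′ , + (h ℕ.∸ B i)) ≺ φ⁻² ⊹ φ⁻¹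
    P′≺φ⁻²+φ⁻¹ = ≺-trans (≺-≼-trans P′≺P+φ⁻² (≼-shift φ⁻² (Good⇒≼φ⁻² good))) (≺-shift φ⁻² φ⁻²≺φ⁻¹)
    1≤k = φ⁻²≺∧<1⇒1≤ c′ (h ℕ.∸ B i) φ⁻²≺P′ P′≺φ⁻²+φ⁻¹

  -- The left parent need not be good. Left moves to the good heap that `Good-below` puts in its
  -- place, whose value is at least that of the parent.
  below-left-parent : ∀ a b → a ℕ.≤ 2 ^ b → point a b ≺ point m k → H a b ℕ.< H m k → ∀ ac → ¬
      (heapAcc h ac ≤ᴳ fracGame a b)
  below-left-parent a b a≤ lt Hlt ac
    with c′ , e , g , e≤ , le , E≺P ← Good-below good
        (subst (H a b ℕ.<_) (ℤP.+-injective (cong proj₂ eq)) Hlt) (O≼point a b a≤)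
        (subst (point a b ≺_) eq lt)
    with a′ , b′ , a′≤ , eq′ , _ , val ← smaller
        (ℕP.≤-<-trans e≤ (subst (H a b ℕ.<_) (ℤP.+-injective (cong proj₂ eq)) Hlt)) g E≺P =
    Left-refutes (A-move (ℕP.≤-trans e≤ (ℕP.<⇒≤ (subst (H a b ℕ.<_)
        (ℤP.+-injective (cong proj₂ eq)) Hlt))) E≺P
        (≺-≼-trans (≼-≺-trans (Good⇒≼φ⁻² good) φ⁻²≺φ⁻¹) (≼-shift φ⁻¹ (Good⇒O≼ g))))
      (λ ac → ≤ᴳ-trans _ _ _ (fractionGame-mono a b a′ b′ (point-cancel-≼ a b a′ b′ a≤
          (subst (point a b ≼_) (sym eq′) le))) (proj₂ (val ac))) ac

  -- The right parent is good by `Good-above`, so Right moves to it. The distance stays below φ⁻²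
  -- because the point of h is not `O`: the empty heap has no smaller one.
  above-right-parent : ∀ a b → a ℕ.≤ 2 ^ b → point m k ≺ point a b → H a b ℕ.< H m k → ∀ ac → ¬
      (fracGame a b ≤ᴳ heapAcc h ac)
  above-right-parent a b a≤ lt Hlt = Right-refutes
      (B-move (ℕP.<⇒≤ H<h) P≺R (≼-≺-trans (point-≤φ⁻² a b a≤) (≺-shift φ⁻² (O≺P (Good⇒O≼ good)))))
      (λ ac → proj₁ (rec H<h (+ C a b) a b (Good-above good H<h P≺R (point-≤φ⁻² a b a≤)) a≤ refl
          ac))
    where
    H<h : H a b ℕ.< h
    H<h = subst (H a b ℕ.<_) (ℤP.+-injective (cong proj₂ eq)) Hlt
    P≺R : P ≺ point a b
    P≺R = subst (_≺ point a b) eq lt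
    O≺P : O ≼ P → O ≺ P
    O≺P (inj₁ p) = p
    O≺P (inj₂ refl) = ⊥-elim (ℕP.n≮0 H<h)

hasValue : ∀ h → HasValue h
hasValue = <-rec HasValue go
  where
  go : ∀ h → (∀ {h′} → h′ ℕ.< h → HasValue h′) → HasValue h
  go h rec c m k g m≤ eq ac with options? m k m≤
  go h rec c m .(suc j) g m≤ eq ac | inj₂ (n , j , refl , refl) =
    subst (heapAcc h ac ≈ᴳ_) (sym (fracGame-even n j))
      (go h rec c n j g (ℕP.*-cancelˡ-≤ 2 (subst (ℕ._≤ 2 ^ suc j) (sym (2*≡double n)) m≤))
          (trans (sym (point-even n j)) eq) ac)
  go h rec c m k g m≤ eq ac@(acc rs) | inj₁ o =
      subst (heapAcc h ac ≤ᴳ_) (sym O.isGame)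
        ( (λ { (i , 1≤i , Ai≤h) X≤ → Left-option h rec c g m k m≤ eq i 1≤i Ai≤h
            (rs (ℕP.∸-monoʳ-< (A-positive 1≤i) Ai≤h))
            (subst (_≤ᴳ heapAcc (h ℕ.∸ A i) (rs (ℕP.∸-monoʳ-< (A-positive 1≤i) Ai≤h)))
            (sym O.isGame) X≤) })
        , (λ j X≤ → let a , b , eq′ , a≤ , lt , Hlt = O.right j in
             above-right-parent h rec c g m k m≤ eq a b a≤ lt Hlt ac
                 (subst (_≤ᴳ heapAcc h ac) eq′ X≤)))
    , subst (_≤ᴳ heapAcc h ac) (sym O.isGame)
        ( (λ i ≤X → let a , b , eq′ , a≤ , lt , Hlt = O.left i in
             below-left-parent h rec c g m k m≤ eq a b a≤ lt Hlt ac
                 (subst (heapAcc h ac ≤ᴳ_) eq′ ≤X))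
        , (λ { (i , 1≤i , Bi≤h) ≤X → Right-option h rec c g m k m≤ eq i 1≤i Bi≤h
            (rs (ℕP.∸-monoʳ-< (B-positive 1≤i) Bi≤h))
            (subst (heapAcc (h ℕ.∸ B i) (rs (ℕP.∸-monoʳ-< (B-positive 1≤i) Bi≤h)) ≤ᴳ_)
            (sym O.isGame) ≤X) }))
    where module O = Options o

-- Membership in 𝒬, and uniqueness of the preimage.

÷φ² : ∀ {x y} → Pos x y → Pos (+ 2 * x - y) (y - x)
÷φ² {x} {y} p = ÷φ (÷φ (cast (e₁ x y) (e₂ x y) p))
  where
  e₁ : ∀ x y → x ≡ (+ 2 * x - y) + (y - x)
  e₁ = solve-∀
  e₂ : ∀ x y → y ≡ (y - x) + ((+ 2 * x - y) + (y - x))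
  e₂ = solve-∀

-- Let t in (0 , 1) be the fractional part of nφ², and `q = n + p` its floor. Then B q = 2n + 3p,
-- with qφ² - B q = tφ⁻², and the point of B q + 1 is φ⁻² - tφ⁻⁴; this exceeds φ⁻³ because φ⁻² = φ⁻³
-- + φ⁻⁴.
BB+1-Good : ∀ n → 1 ℕ.≤ n → ∃[ c ] Good c (B (B n) ℕ.+ 1)
BB+1-Good n 1≤n = conclude (B n) (B-isFloor n 1≤n)
  where
  conclude : ∀ q → IsFloor q n n → ∃[ c ] Good c (B q ℕ.+ 1)
  conclude q (low , high) with n ℕ.≤? q
  ... | no n≰q = ⊥-elim (¬Pos-≤0 (ℤP.i≤j⇒i-j≤0 (ℤ.+≤+ (ℕP.≰⇒> n≰q))) (ℤP.neg-≤-pos {n} {0}) high)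
  ... | yes n≤q with p , refl ← ℕP.m≤n⇒∃[o]m+o≡n n≤q =
      + 2 + + 3 * + n + + 5 * + p
    , subst (Good _) (cong (ℕ._+ 1) (sym Bq))
        (window [ cast (a₁ (+ n) (+ p)) (a₂ (+ n) (+ p)) (÷φ² (÷φ² high)) ]
          (inj₁ [ cast (b₁ (+ n) (+ p)) (b₂ (+ n) (+ p)) (÷φ² (÷φ² low)) ]))
    where
    b = n ℕ.+ (n ℕ.+ p ℕ.+ p ℕ.+ p)
    c₁ : ∀ n p → + 2 * (n - (n + p)) - n ≡ (n + p) - (n + (n + p + p + p))
    c₁ = solve-∀
    c₂ : ∀ n p → n - (n - (n + p)) ≡ n + p
    c₂ = solve-∀
    d₁ : ∀ n p → + 2 * ((+ 1 + (n + p)) - n) - - n + -[1+ 0 ] ≡ (+ 1 + (n + (n + p + p + p)))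
        - (n + p)
    d₁ = solve-∀
    d₂ : ∀ n p → - n - ((+ 1 + (n + p)) - n) + + 1 ≡ - (n + p)
    d₂ = solve-∀
    Bq : B (n ℕ.+ p) ≡ b
    Bq = IsFloor-unique (B-isFloor (n ℕ.+ p) (ℕP.≤-trans 1≤n n≤q))
      ( cast (c₁ (+ n) (+ p)) (c₂ (+ n) (+ p)) (÷φ² low)
      -- This is 1 - tφ⁻² = (1 - t)φ⁻² + φ⁻¹.
      , cast (d₁ (+ n) (+ p)) (d₂ (+ n) (+ p)) (÷φ² high ⊕ ÷φ { -[1+ 0 ]} {+ 1} rat⁺))
    a₁ : ∀ n p → let x = (+ 1 + (n + p)) - n ; y = - n in
      + 2 * (+ 2 * x - y) - (y - x) ≡ (+ 2 + + 3 * n + + 5 * p) - -[1+ 2 ]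
    a₁ = solve-∀
    a₂ : ∀ n p → let x = (+ 1 + (n + p)) - n ; y = - n in
      (y - x) - (+ 2 * x - y) ≡ -[1+ 1 ] - (n + (n + p + p + p) + + 1)
    a₂ = solve-∀
    b₁ : ∀ n p → let x = n - (n + p) ; y = n in
      + 2 * (+ 2 * x - y) - (y - x) ≡ + 2 - (+ 2 + + 3 * n + + 5 * p)
    b₁ = solve-∀
    b₂ : ∀ n p → let x = n - (n + p) ; y = n in
      (y - x) - (+ 2 * x - y) ≡ (n + (n + p + p + p) + + 1) - + 1
    b₂ = solve-∀

𝒬⇒Good : ∀ {h} → 𝒬 h → ∃[ c ] Good c h
𝒬⇒Good (inj₁ (n , 1≤n , refl)) = BB+1-Good n 1≤n
𝒬⇒Good (inj₂ (n , refl)) = + Fᵉ (suc (suc n)) - + 3 , exceptional n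
  (trans (cong (λ t → + Fᵉ (suc (suc n)) - + 3 + + 3 , + (t ℕ.∸ 2) + + 2)
      (cong F (trans (ℕP.+-comm (2 ℕ.* n) 3) (cong (3 ℕ.+_) (2*≡double n)))))
    (exceptional-point n))

-- The first exceptional heap after 0 is 3, with point φ⁻³ - φ⁻⁵ = φ⁻⁴, the point of 1/2; hence the
-- lower bound for δ.
Good⇒φ⁻⁴≼ : ∀ {c h} → h ≢ 0 → Good c h → φ⁻⁴ ≼ (c , + h)
Good⇒φ⁻⁴≼ _ (window p _) = inj₁ (≺-trans φ⁻⁴≺φ⁻³ p)
Good⇒φ⁻⁴≼ {c} h≢0 (exceptional zero eq) = ⊥-elim
    (h≢0 (ℕP.+-cancelʳ-≡ 2 _ 0 (size-of-exceptional {c} 0 eq)))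
Good⇒φ⁻⁴≼ _ (exceptional (suc n) eq) = ≼-unshift -φ⁻³
    (subst (oddPower 2 ≼_) (sym eq) (odd-increasing {2} {suc (suc n)} (s≤s (s≤s z≤n))))

-- Points of one heap differ by integers, and [0 , φ⁻²] is shorter than 1.
same-size : ∀ {c c′ h} → O ≼ (c , h) → (c′ , h) ≼ φ⁻² → ¬ ((c , h) ≺ (c′ , h))
same-size {c} {c′} {h} low high [ p ] with ≺-≼-trans (≼-≺-trans high φ⁻²≺1)
    (≼-shift (+ 1 , + 0) low)
  where
  φ⁻²≺1 : φ⁻² ≺ (+ 1 , + 0)
  φ⁻²≺1 = [ ÷φ rat⁺ ]
... | [ q ] = ¬Pos-≤0 (subst (ℤ._≤ + 0) (e₃ c c′) (ℤP.neg-mono-≤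
    (Pos-suc⇒0≤ (c - c′) (cast (e₁ c c′) (e₂ h) q))))
                (ℤP.≤-reflexive (ℤP.+-inverseʳ h)) p
  where
  e₁ : ∀ c c′ → (c + + 1) - c′ ≡ + 1 + (c - c′)
  e₁ = solve-∀
  e₂ : ∀ h → h - (h + + 0) ≡ + 0
  e₂ = solve-∀
  e₃ : ∀ c c′ → - (c - c′) ≡ c′ - c
  e₃ = solve-∀

½≤/ : ∀ m d .{{_ : ℕ.NonZero d}} → d ℕ.≤ m ℕ.* 2 → ℚᵘ.½ ℚᵘ.≤ (+ m ℚᵘ./ d)
½≤/ m (suc d) le = ℚᵘ.*≤* (subst₂ ℤ._≤_ (sym (ℤP.*-identityˡ (+ suc d))) (ℤP.pos-* m 2) (ℤ.+≤+ le))

/≤1 : ∀ m d .{{_ : ℕ.NonZero d}} → m ℕ.≤ d → (+ m ℚᵘ./ d) ℚᵘ.≤ ℚᵘ.1ℚᵘ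
/≤1 m (suc d) le = ℚᵘ.*≤* (subst₂ ℤ._≤_ (sym (ℤP.*-identityʳ (+ m)))
    (sym (ℤP.*-identityˡ (+ suc d))) (ℤ.+≤+ le))

/≤1⁻¹ : ∀ m d .{{_ : ℕ.NonZero d}} → (+ m ℚᵘ./ d) ℚᵘ.≤ ℚᵘ.1ℚᵘ → m ℕ.≤ d
/≤1⁻¹ m (suc d) (ℚᵘ.*≤* le) = ℤP.drop‿+≤+ (subst₂ ℤ._≤_ (ℤP.*-identityʳ (+ m))
    (ℤP.*-identityˡ (+ suc d)) le)

½≰negative : ∀ m d .{{_ : ℕ.NonZero d}} → ¬ (ℚᵘ.½ ℚᵘ.≤ (-[1+ m ] ℚᵘ./ d))
½≰negative m (suc d) (ℚᵘ.*≤* ())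

cross-≃ : ∀ m d m′ d′ .{{_ : ℕ.NonZero d}} .{{_ : ℕ.NonZero d′}} → m ℕ.* d′ ≡ m′ ℕ.* d →
    (+ m ℚᵘ./ d) ℚᵘ.≃ (+ m′ ℚᵘ./ d′)
cross-≃ m (suc d) m′ (suc d′) eq = ℚᵘ.*≡* (trans (sym (ℤP.pos-* m (suc d′)))
    (trans (cong +_ eq) (ℤP.pos-* m′ (suc d))))

point-injective : ∀ m k m′ k′ → m ℕ.≤ 2 ^ k → m′ ℕ.≤ 2 ^ k′ → H m k ≡ H m′ k′ → m ℕ.* 2 ^ k′ ≡ m′
    ℕ.* 2 ^ k
point-injective m k m′ k′ m≤ m′≤ eq = ℕP.≤-antisym
    (point-cancel-≼ m k m′ k′ m≤ (inj₂ same))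
    (point-cancel-≼ m′ k′ m k m′≤ (inj₂ (sym same)))
  where
  lift : ∀ m k m′ k′ → m ℕ.≤ 2 ^ k → m′ ℕ.≤ 2 ^ k′ → H m k ≡ H m′ k′ → ¬ (point m k ≺ point m′ k′)
  lift m k m′ k′ m≤ m′≤ eq = subst (λ h → ¬ (point m k ≺ (+ C m′ k′ , + h))) eq
    (same-size (O≼point m k m≤) (subst (λ h → (+ C m′ k′ , + h) ≼ φ⁻²) (sym eq)
        (point-≤φ⁻² m′ k′ m′≤)))
  same : point m k ≡ point m′ k′
  same with compare (point m k) (point m′ k′)
  ... | inj₁ p = ⊥-elim (lift m k m′ k′ m≤ m′≤ eq p)
  ... | inj₂ (inj₁ p) = p
  ... | inj₂ (inj₂ p) = ⊥-elim (lift m′ k′ m k m′≤ m≤ (sym eq) p)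

theorem4p9 : ∀ (h : ℕ) → 𝒬 h → h ≢ 0 →
    ∃[ d ] (d isδ h × GoldenNugget h ≈ᴳ dyadicGame d)
theorem4p9 h h∈𝒬 h≢0
  with c , good ← 𝒬⇒Good h∈𝒬
  with m , k , m≤ , eq ← surjective c h (Good⇒O≼ good) (Good⇒≼φ⁻² good) =
    (+ m) /2^ k
  , ( ( ½≤/ m (2 ^ k) {{ℕP.m^n≢0 2 k}} (subst (ℕ._≤ m ℕ.* 2) (ℕP.*-identityˡ (2 ^ k))
          (point-cancel-≼ 1 1 m k (s≤s z≤n) (subst (φ⁻⁴ ≼_) (sym eq) (Good⇒φ⁻⁴≼ h≢0 good))))
      , /≤1 m (2 ^ k) {{ℕP.m^n≢0 2 k}} m≤
      , trans (ξ≡H m k) Hmk≡h)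
    , unique)
  , hasValue h c m k good m≤ eq (<-wellFounded h)
  where
  Hmk≡h : H m k ≡ h
  Hmk≡h = ℤP.+-injective (cong proj₂ eq)
  unique : ∀ d′ → Inξ⁻¹ h d′ → toℚᵘ d′ ℚᵘ.≃ toℚᵘ ((+ m) /2^ k)
  unique (-[1+ m′ ] /2^ k′) (½≤ , _ , _) = ⊥-elim (½≰negative m′ (2 ^ k′) {{ℕP.m^n≢0 2 k′}} ½≤)
  unique ((+ m′) /2^ k′) (_ , ≤1 , ξ≡h) =
    cross-≃ m′ (2 ^ k′) m (2 ^ k) {{ℕP.m^n≢0 2 k′}} {{ℕP.m^n≢0 2 k}}
      (point-injective m′ k′ m k (/≤1⁻¹ m′ (2 ^ k′) {{ℕP.m^n≢0 2 k′}} ≤1) m≤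
        (trans (sym (ξ≡H m′ k′)) (trans ξ≡h (sym Hmk≡h))))
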